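{- Let $G$ be a connected graph and let $f$ be a positive integer-valued function on $V(G)$. If for all $S\subseteq V(G)$, $\omega(G\setminus S)\le\sum_{v\in S}\big(f(v)-2\big)+2$, then every spanning forest $F$ of $G$ can be extended to a spanning tree $T$ of $G$ such that for each vertex $v$, $d_T(v)\le f(v)+\max\{0,d_F(v)-1\}$.
   Context: All graphs are finite, without loops, multiple edges allowed. $\omega(H)$ is the number of components of $H$ (the null graph has $0$ components); $G\setminus S$ is obtained by deleting the vertices of $S$. -}

module Defs where

open import Data.Nat using (ℕ; _≤_; _∸_; _+_)
open import Data.Integer as ℤ using (ℤ)
open import Data.Fin using (Fin; _≟_)
open import Data.Fin.Subset using (Subset; _∈_; _∉_; ∁; ⊤)
open import Data.Fin.Subset.Properties using (_∈?_)
open import Data.List using (List; []; _∷_; length; filter; allFin; map; foldr)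
open import Data.List.Relation.Unary.Unique.Propositional using (Unique)
open import Data.Product using (Σ; _×_; _,_; proj₁; proj₂)
open import Data.Sum using (_⊎_)
open import Relation.Nullary using (¬_; _×-dec_; _⊎-dec_)
open import Relation.Binary.PropositionalEquality using (_≡_; _≢_)
open import Function.Definitions using (Surjective)

-- A finite multigraph without loops: vertices Fin n, edges Fin m,
-- edge e has end-vertices ends e (parallel edges allowed).
record Graph : Set where
  field
    n     : ℕ
    m     : ℕ
    ends  : Fin m → Fin n × Fin n
    loopless : ∀ e → proj₁ (ends e) ≢ proj₂ (ends e)

open Graph public

Joins : (G : Graph) → Fin (m G) → Fin (n G) → Fin (n G) → Set
Joins G e u w = (ends G e ≡ (u , w)) ⊎ (ends G e ≡ (w , u))

data Walk (G : Graph) (U : Subset (n G)) (E : Subset (m G))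
     : Fin (n G) → Fin (n G) → List (Fin (m G)) → Set where
  nil  : ∀ {v} → v ∈ U → Walk G U E v v []
  cons : ∀ {u w v es} (e : Fin (m G)) → e ∈ E → Joins G e u w → u ∈ U →
         Walk G U E w v es → Walk G U E u v (e ∷ es)

Connected : (G : Graph) → Subset (n G) → Subset (m G) → Fin (n G) → Fin (n G) → Set
Connected G U E u v = Σ (List (Fin (m G))) (λ es → Walk G U E u v es)

VertOut : (G : Graph) → Subset (n G) → Set
VertOut G S = Σ (Fin (n G)) (λ v → v ∉ S)

-- ω(G \ S) = k : the components of G \ S (all edges of G among the
-- remaining vertices) are in bijection with Fin k, i.e. there is a surjective
-- labelling c of the vertices of G \ S by Fin k with c x ≡ c y exactly when
-- x and y are connected in G \ S.
HasComponents : (G : Graph) → Subset (n G) → ℕ → Set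
HasComponents G S k =
  Σ (VertOut G S → Fin k) λ c →
    Surjective _≡_ _≡_ c ×
    (∀ x y → (c x ≡ c y → Connected G (∁ S) ⊤ (proj₁ x) (proj₁ y)) ×
             (Connected G (∁ S) ⊤ (proj₁ x) (proj₁ y) → c x ≡ c y))

IsConnected : Graph → Set
IsConnected G = ∀ u v → Connected G ⊤ ⊤ u v

Acyclic : (G : Graph) → Subset (m G) → Set
Acyclic G E = ∀ v es → Walk G ⊤ E v v es → Unique es → es ≡ []

SpanningForest : (G : Graph) → Subset (m G) → Set
SpanningForest G F = Acyclic G F

SpanningTree : (G : Graph) → Subset (m G) → Set
SpanningTree G T = Acyclic G T × (∀ u v → Connected G ⊤ T u v)

deg : (G : Graph) → Subset (m G) → Fin (n G) → ℕ
deg G E v = length (filter (λ e → (e ∈? E) ×-dec ((v ≟ proj₁ (ends G e)) ⊎-dec (v ≟ proj₂ (ends G e)))) (allFin (m G)))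

sumOver : (G : Graph) → Subset (n G) → (Fin (n G) → ℤ) → ℤ
sumOver G S g = foldr ℤ._+_ (ℤ.+ 0) (map g (filter (λ v → v ∈? S) (allFin (n G))))

{-# OPTIONS --safe #-}
-- Among the spanning trees containing F, take T with minimal total excess over
-- b v = f v + (d_F v ∸ 1), and suppose that some w has d_T w > b w.  Starting from A = F and
-- S = {v | d_T v ≥ b v}, grow A inside T and shrink S while maintaining that any vertices off S in
-- distinct A-components can simultaneously be given one unit of slack by replacing A with another
-- edge set of no greater size spanning the same components (a local search in the style of Fürer and Raghavachari).
-- An edge of G off S that joins two A-components allows a further step.  If w leaves S, its slack gives a
-- tree with smaller excess.  Otherwise no edge of G ∖ S joins two A-components; then with k = ω(G ∖ S),
-- H = T ∖ F and S₀ = {v ∈ S | d_F v = 0}, counting components of A gives |T ∖ A| + 1 ≤ k + |S₀| + |F[S]|,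
-- and together with Σ_S d_H ≤ |T ∖ A| + |H[S]| and |T[S]| < |S| this contradicts the bound on k.
module Submission where

open import Defs
open import Data.Nat using (ℕ; zero; suc; _≤_; _<_; _∸_; _+_; _*_; _⊔_; z≤n; s≤s)
open import Data.Nat.Properties renaming (_≟_ to _≟ℕ_)
open import Data.Nat.Induction using (<-wellFounded)
open import Data.Nat.Tactic.RingSolver using (solve-∀)
open import Data.Integer.Tactic.RingSolver using () renaming (solve-∀ to ℤ-solve-∀)
open import Data.Integer as ℤ using (ℤ)
import Data.Integer.Properties as ℤₚ
open import Data.Bool using (Bool; true; false; not; _∧_; _∨_)
open import Data.Bool.Properties
  using (¬-not; not-¬; ∨-zeroʳ; ∨-identityʳ; ∧-identityʳ) renaming (_≟_ to _≟ᵇ_)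
open import Data.Fin using (Fin; zero; suc; _≟_)
open import Data.Fin.Properties using (any?; injective⇒≤)
open import Data.Fin.Subset as Sub using (Subset; _⊆_)
open import Data.Fin.Subset.Properties using (_∈?_; ∈⊤; x∉p⇒x∈∁p; x∈∁p⇒x∉p)
open import Data.List as List using (List; []; _∷_; _++_; length; lookup; filter; map; foldr; allFin)
open import Data.List.Membership.Propositional using (_∈_; find; lose)
open import Data.List.Membership.Propositional.Properties using (∈-lookup; ∈-allFin; ∈-filter⁺; ∈-map⁺)
open import Data.List.Properties using (length-++; length-map)
open import Data.List.Relation.Unary.All as All using (All; []; _∷_)
open import Data.List.Relation.Unary.AllPairs as AllPairs using (AllPairs; []; _∷_)
open import Data.List.Relation.Unary.Any as Any using (Any; here; there; index)
open import Data.List.Relation.Unary.Unique.Propositional using (Unique)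
open import Data.List.Relation.Unary.Any.Properties using (lookup-index; ++⁺ˡ; ++⁺ʳ)
open import Data.Product using (Σ; ∃; _×_; _,_; proj₁; proj₂)
open import Data.Sum using (_⊎_; inj₁; inj₂; [_,_]′)
open import Data.Vec as Vec using (tabulate)
open import Data.Vec.Properties using ([]=⇒lookup; lookup⇒[]=; lookup∘tabulate)
open import Data.Empty using (⊥; ⊥-elim)
open import Function using (_∘_; id; const)
open import Function.Definitions using (Surjective)
open import Induction.WellFounded using (Acc; acc)
open import Relation.Nullary using (¬_; Dec; yes; no; does; contradiction; map′; _×-dec_; _⊎-dec_)
open import Relation.Nullary.Decidable using (dec-true; dec-false; ¬?; decidable-stable)
open import Relation.Unary using (Decidable)
open import Relation.Binary.PropositionalEquality
  using (_≡_; _≢_; refl; sym; trans; cong; cong₂; subst; module ≡-Reasoning)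
import Relation.Binary.PropositionalEquality.Properties as Eq
open import Relation.Binary.Structures using (IsEquivalence)
open import Relation.Binary.Construct.Closure.Equivalence as EqC using (EqClosure)
open import Algebra.Properties.CommutativeMonoid.Sum +-0-commutativeMonoid
  using (sum; sum-cong-≗; ∑-distrib-+; ∑-comm; sum-replicate-zero)
open import Algebra.Properties.Semiring.Sum +-*-semiring using (*-distribˡ-sum)

-- Indicator functions and weighted sums

χ : Bool → ℕ
χ false = 0
χ true  = 1

χ≤1 : ∀ x → χ x ≤ 1
χ≤1 false = z≤n
χ≤1 true  = ≤-refl

χ-∨ : ∀ x y → χ (x ∨ y) ≤ χ x + χ y
χ-∨ false y = ≤-refl
χ-∨ true  y = s≤s z≤n

χ-false : ∀ {x} → x ≢ true → χ x ≡ 0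
χ-false {false} _ = refl
χ-false {true}  p = contradiction refl p

∧-true : ∀ {x y} → x ≡ true → y ≡ true → x ∧ y ≡ true
∧-true refl refl = refl

∧-trueˡ : ∀ {x y} → x ∧ y ≡ true → x ≡ true
∧-trueˡ {true} _ = refl

∧-trueʳ : ∀ {x y} → x ∧ y ≡ true → y ≡ true
∧-trueʳ {true} p = p

not-true : ∀ {x} → not x ≡ true → x ≡ false
not-true {false} _ = refl

dec-true⁻¹ : ∀ {P : Set} (P? : Dec P) → does P? ≡ true → P
dec-true⁻¹ (yes p) _ = p

dec-false⁻¹ : ∀ {P : Set} (P? : Dec P) → does P? ≡ false → ¬ P
dec-false⁻¹ (no ¬p) _ = ¬p

infix 7 _·_

_·_ : ∀ {k} → (Fin k → ℕ) → (Fin k → ℕ) → ℕ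
μ · w = sum λ i → μ i * w i

⟦_⟧ : ∀ {k} → (Fin k → Bool) → Fin k → ℕ
⟦ E ⟧ i = χ (E i)

δ : ∀ {k} → Fin k → Fin k → Bool
δ i j = does (i ≟ j)

δ-refl : ∀ {k} (i : Fin k) → δ i i ≡ true
δ-refl i = dec-true (i ≟ i) refl

δ-sym : ∀ {k} (i j : Fin k) → δ i j ≡ δ j i
δ-sym i j with i ≟ j
... | yes refl = sym (δ-refl i)
... | no i≢j   = sym (dec-false (j ≟ i) (i≢j ∘ sym))

χ-δ-≢ : ∀ {k} {i j : Fin k} → i ≢ j → χ (δ i j) ≡ 0
χ-δ-≢ {i = i} {j} i≢j = cong χ (dec-false (i ≟ j) i≢j)

size : ∀ {k} → (Fin k → Bool) → ℕ
size E = sum ⟦ E ⟧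

sum-mono : ∀ {k} {f g : Fin k → ℕ} → (∀ i → f i ≤ g i) → sum f ≤ sum g
sum-mono {zero}  p = z≤n
sum-mono {suc k} p = +-mono-≤ (p zero) (sum-mono (p ∘ suc))

sum-const-1 : ∀ k → sum {k} (const 1) ≡ k
sum-const-1 zero    = refl
sum-const-1 (suc k) = cong suc (sum-const-1 k)

·-mono : ∀ {k} {μ ν : Fin k → ℕ} (w : Fin k → ℕ) → (∀ i → μ i ≤ ν i) → μ · w ≤ ν · w
·-mono w p = sum-mono λ i → *-monoˡ-≤ (w i) (p i)

·-+ : ∀ {k} (μ ν w : Fin k → ℕ) → (λ i → μ i + ν i) · w ≡ μ · w + ν · w
·-+ μ ν w = trans (sum-cong-≗ λ i → *-distribʳ-+ (w i) (μ i) (ν i)) (∑-distrib-+ (λ i → μ i * w i) _)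

·-1 : ∀ {k} (μ : Fin k → ℕ) → μ · const 1 ≡ sum μ
·-1 μ = sum-cong-≗ λ i → *-identityʳ (μ i)

⟦δ⟧-· : ∀ {k} (i : Fin k) w → ⟦ δ i ⟧ · w ≡ w i
⟦δ⟧-· {suc k} zero w = trans (cong₂ _+_ (+-identityʳ _) (sum-replicate-zero k)) (+-identityʳ _)
⟦δ⟧-· {suc k} (suc i) w = ⟦δ⟧-· i (w ∘ suc)

size-δ : ∀ {k} (i : Fin k) → size (δ i) ≡ 1
size-δ i = trans (sym (·-1 ⟦ δ i ⟧)) (⟦δ⟧-· i (const 1))

-- For linear arithmetic: p ≤ q is a sum of hypotheses, and the ring solver proves the equation.
≤-from : ∀ {p q a b} → p ≤ q → a + q ≡ b + p → a ≤ b
≤-from {p} {q} {a} {b} p≤q eq =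
  +-cancelʳ-≤ q a b (≤-trans (≤-reflexive eq) (+-monoʳ-≤ b p≤q))

length-filter-tabulate : ∀ {k} {A : Set} {P : A → Set} (P? : Decidable P) (f : Fin k → A) →
  length (filter P? (List.tabulate f)) ≡ size (does ∘ P? ∘ f)
length-filter-tabulate {zero}  P? f = refl
length-filter-tabulate {suc k} P? f with does (P? (f zero))
... | true  = cong suc (length-filter-tabulate P? (f ∘ suc))
... | false = length-filter-tabulate P? (f ∘ suc)

-- The integer sum of `g - 2` over a set is carried into the naturals by moving twice the size of
-- the set to the other side, so that all later counting avoids subtraction.
sum-filter-tabulate : ∀ {k} {A : Set} {P : A → Set} (P? : Decidable P) (g : A → ℕ) (h : Fin k → A) →
  foldr ℤ._+_ (ℤ.+ 0) (map (λ a → ℤ.+ g a ℤ.- ℤ.+ 2) (filter P? (List.tabulate h)))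
    ℤ.+ ℤ.+ (2 * size (does ∘ P? ∘ h)) ≡ ℤ.+ (⟦ does ∘ P? ∘ h ⟧ · (g ∘ h))
sum-filter-tabulate {zero}  P? g h = refl
sum-filter-tabulate {suc k} P? g h with does (P? (h zero))
... | false = sum-filter-tabulate P? g (h ∘ suc)
... | true  = begin
  (ℤ.+ x ℤ.- ℤ.+ 2 ℤ.+ s) ℤ.+ ℤ.+ (2 * (1 + c))           ≡⟨ cong (λ z → (ℤ.+ x ℤ.- ℤ.+ 2 ℤ.+ s) ℤ.+ ℤ.+ z) (*-distribˡ-+ 2 1 c) ⟩
  (ℤ.+ x ℤ.- ℤ.+ 2 ℤ.+ s) ℤ.+ (ℤ.+ 2 ℤ.+ ℤ.+ (2 * c))     ≡⟨ rearrange (ℤ.+ x) s (ℤ.+ (2 * c)) ⟩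
  ℤ.+ x ℤ.+ (s ℤ.+ ℤ.+ (2 * c))                           ≡⟨ cong (λ z → ℤ.+ x ℤ.+ z) (sum-filter-tabulate P? g (h ∘ suc)) ⟩
  ℤ.+ (x + ⟦ does ∘ P? ∘ h ∘ suc ⟧ · (g ∘ h ∘ suc))       ≡⟨ cong (λ z → ℤ.+ (z + ⟦ does ∘ P? ∘ h ∘ suc ⟧ · (g ∘ h ∘ suc))) (*-identityˡ x) ⟨
  ℤ.+ (1 * x + ⟦ does ∘ P? ∘ h ∘ suc ⟧ · (g ∘ h ∘ suc))   ∎
  where
  open ≡-Reasoning
  x = g (h zero)
  s = foldr ℤ._+_ (ℤ.+ 0) (map (λ a → ℤ.+ g a ℤ.- ℤ.+ 2) (filter P? (List.tabulate (h ∘ suc))))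
  c = size (does ∘ P? ∘ h ∘ suc)
  rearrange : ∀ x s c → (x ℤ.- ℤ.+ 2 ℤ.+ s) ℤ.+ (ℤ.+ 2 ℤ.+ c) ≡ x ℤ.+ (s ℤ.+ c)
  rearrange = ℤ-solve-∀

-- Finite sets as Boolean functions

infix 4 _⊑_

_⊑_ : ∀ {k} → (Fin k → Bool) → (Fin k → Bool) → Set
D ⊑ E = ∀ e → D e ≡ true → E e ≡ true

infixl 6 _─_

_─_ : ∀ {k} → (Fin k → Bool) → (Fin k → Bool) → Fin k → Bool
(E ─ D) e = E e ∧ not (D e)

·-─ : ∀ {k} {D E : Fin k → Bool} → D ⊑ E → ∀ w → ⟦ E ⟧ · w ≡ ⟦ D ⟧ · w + ⟦ E ─ D ⟧ · w
·-─ {D = D} {E} D⊑E w =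
  trans (sum-cong-≗ λ e → cong (_* w e) (pointwise e)) (·-+ ⟦ D ⟧ ⟦ E ─ D ⟧ w)
  where
  pointwise : ∀ e → χ (E e) ≡ χ (D e) + χ ((E ─ D) e)
  pointwise e with D e in e∈D
  ... | true rewrite D⊑E e e∈D = refl
  ... | false with E e
  ...   | true  = refl
  ...   | false = refl

size-─ : ∀ {k} {D E : Fin k → Bool} → D ⊑ E → size E ≡ size D + size (E ─ D)
size-─ {D = D} {E} D⊑E = trans (sym (·-1 ⟦ E ⟧))
  (trans (·-─ D⊑E (const 1)) (cong₂ _+_ (·-1 ⟦ D ⟧) (·-1 ⟦ E ─ D ⟧)))

size-mono : ∀ {k} {D E : Fin k → Bool} → D ⊑ E → size D ≤ size E
size-mono D⊑E = ≤-trans (m≤m+n _ _) (≤-reflexive (sym (size-─ D⊑E)))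

infixr 6 _∪_

_∪_ : ∀ {k} → (Fin k → Bool) → (Fin k → Bool) → Fin k → Bool
(D ∪ E) e = D e ∨ E e

∪-⊑ˡ : ∀ {k} (D E : Fin k → Bool) → D ⊑ D ∪ E
∪-⊑ˡ D E e e∈D = cong (_∨ E e) e∈D

∪-⊑ʳ : ∀ {k} (D E : Fin k → Bool) → E ⊑ D ∪ E
∪-⊑ʳ D E e e∈E = trans (cong (D e ∨_) e∈E) (∨-zeroʳ (D e))

·-∪ : ∀ {k} (D E : Fin k → Bool) w → ⟦ D ∪ E ⟧ · w ≤ ⟦ D ⟧ · w + ⟦ E ⟧ · w
·-∪ D E w = ≤-trans (·-mono w λ e → χ-∨ (D e) (E e)) (≤-reflexive (·-+ ⟦ D ⟧ ⟦ E ⟧ w))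

size-∪ : ∀ {k} (D E : Fin k → Bool) → size (D ∪ E) ≤ size D + size E
size-∪ D E = ≤-trans (sum-mono λ e → χ-∨ (D e) (E e)) (≤-reflexive (∑-distrib-+ ⟦ D ⟧ ⟦ E ⟧))

infixl 6 _∖_

_∖_ : ∀ {k} → (Fin k → Bool) → Fin k → Fin k → Bool
E ∖ e = E ─ δ e

∖-⊑ : ∀ {k} (E : Fin k → Bool) e {h} → (E ∖ e) h ≡ true → E h ≡ true
∖-⊑ E e = ∧-trueˡ

∈-∖ : ∀ {k} (E : Fin k → Bool) e {h} → E h ≡ true → e ≢ h → (E ∖ e) h ≡ true
∈-∖ E e {h} h∈E e≢h = ∧-true h∈E (cong not (dec-false (e ≟ h) e≢h))

∉-∖ : ∀ {k} (E : Fin k → Bool) e → (E ∖ e) e ≢ true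
∉-∖ E e p with not-true (∧-trueʳ {E e} p)
... | q = contradiction (trans (sym q) (δ-refl e)) λ ()

δ-⊑ : ∀ {k} {E : Fin k → Bool} {e} → E e ≡ true → δ e ⊑ E
δ-⊑ {E = E} {e} e∈E h p = trans (cong E (sym (dec-true⁻¹ (e ≟ h) p))) e∈E

·-∖ : ∀ {k} (E : Fin k → Bool) {e} → E e ≡ true → ∀ w → ⟦ E ∖ e ⟧ · w + w e ≡ ⟦ E ⟧ · w
·-∖ E {e} e∈E w = begin
  ⟦ E ∖ e ⟧ · w + w e            ≡⟨ cong (⟦ E ∖ e ⟧ · w +_) (⟦δ⟧-· e w) ⟨
  ⟦ E ∖ e ⟧ · w + ⟦ δ e ⟧ · w    ≡⟨ +-comm (⟦ E ∖ e ⟧ · w) _ ⟩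
  ⟦ δ e ⟧ · w + ⟦ E ∖ e ⟧ · w    ≡⟨ ·-─ {D = δ e} {E} (δ-⊑ e∈E) w ⟨
  ⟦ E ⟧ · w                      ∎
  where open ≡-Reasoning

size-∖ : ∀ {k} (E : Fin k → Bool) {e} → E e ≡ true → size (E ∖ e) + 1 ≡ size E
size-∖ E {e} e∈E = trans (cong (_+ 1) (sym (·-1 ⟦ E ∖ e ⟧))) (trans (·-∖ E e∈E (const 1)) (·-1 ⟦ E ⟧))

size-∖-< : ∀ {k} (E : Fin k → Bool) {e} → E e ≡ true → size (E ∖ e) < size E
size-∖-< E {e} e∈E = ≤-reflexive (trans (+-comm 1 _) (size-∖ E e∈E))

-- The base case covers every function without members, because pointwise equal Boolean functions
-- need not be propositionally equal.
removal-induction : ∀ {k} (P : (Fin k → Bool) → Set) →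
  (∀ E → (∀ e → E e ≢ true) → P E) →
  (∀ E e → E e ≡ true → P (E ∖ e) → P E) → ∀ E → P E
removal-induction P empty remove E = go E (<-wellFounded (size E))
  where
  go : ∀ E → Acc _<_ (size E) → P E
  go E (acc rec) with any? (λ e → E e ≟ᵇ true)
  ... | yes (e , e∈E) = remove E e e∈E (go (E ∖ e) (rec (size-∖-< E e∈E)))
  ... | no none       = empty E λ e e∈E → none (e , e∈E)

-- Minimality is tested only against deleting single elements outside `lo`. This is all the exchange
-- step needs, and greedy deletion reaches it for any decidable `Q`.
Minimal : ∀ {k} → ((Fin k → Bool) → Set) → (lo E : Fin k → Bool) → Set
Minimal Q lo E = Σ _ λ D → lo ⊑ D × D ⊑ E × Q D × (∀ e → D e ≡ true → lo e ≢ true → ¬ Q (D ∖ e))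

minimize : ∀ {k} (Q : (Fin k → Bool) → Set) → Decidable Q →
  ∀ lo E → lo ⊑ E → Q E → Minimal Q lo E
minimize Q Q? lo E lo⊑E q = go E (<-wellFounded (size E)) lo⊑E q
  where
  go : ∀ E → Acc _<_ (size E) → lo ⊑ E → Q E → Minimal Q lo E
  go E (acc rec) lo⊑E q
    with any? (λ e → (E e ≟ᵇ true) ×-dec (¬? (lo e ≟ᵇ true)) ×-dec Q? (E ∖ e))
  ... | no none = E , lo⊑E , (λ _ → id) , q , λ e e∈E e∉lo q′ → none (e , e∈E , e∉lo , q′)
  ... | yes (e , e∈E , e∉lo , q′)
    with go (E ∖ e) (rec (size-∖-< E e∈E))
            (λ h h∈lo → ∈-∖ E e (lo⊑E h h∈lo) λ { refl → e∉lo h∈lo }) q′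
  ...   | D , lo⊑D , D⊑E∖e , qD , min = D , lo⊑D , (λ h → ∖-⊑ E e ∘ D⊑E∖e h) , qD , min

module _ {A : Set} {_~_ : A → A → Set} (~-sym : ∀ {x y} → x ~ y → y ~ x) where

  apart⇒lookup-injective : ∀ {L} → AllPairs (λ x y → ¬ x ~ y) L →
    ∀ {i j} → lookup L i ~ lookup L j → i ≡ j
  apart⇒lookup-injective (x≁L ∷ _) {zero}  {zero}  _ = refl
  apart⇒lookup-injective (x≁L ∷ _) {zero}  {suc j} p = contradiction p (All.lookup x≁L (∈-lookup j))
  apart⇒lookup-injective (x≁L ∷ _) {suc i} {zero}  p = contradiction (~-sym p) (All.lookup x≁L (∈-lookup i))
  apart⇒lookup-injective (_ ∷ ≁)   {suc i} {suc j} p = cong suc (apart⇒lookup-injective ≁ p)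

  apart⇒≡ : ∀ {L} → AllPairs (λ x y → ¬ x ~ y) L → ∀ {x y} → x ∈ L → y ∈ L → x ~ y → x ≡ y
  apart⇒≡ ≁ (here refl) (here refl) p = refl
  apart⇒≡ (x≁L ∷ _) (here refl) (there y∈L) p = contradiction p (All.lookup x≁L y∈L)
  apart⇒≡ (x≁L ∷ _) (there x∈L) (here refl) p = contradiction (~-sym p) (All.lookup x≁L x∈L)
  apart⇒≡ (_ ∷ ≁) (there x∈L) (there y∈L) p = apart⇒≡ ≁ x∈L y∈L p

∈-tabulate⁺ : ∀ {k} {E : Fin k → Bool} {e} → E e ≡ true → e Sub.∈ tabulate E
∈-tabulate⁺ {E = E} {e} p = lookup⇒[]= e (tabulate E) (trans (lookup∘tabulate E e) p)

∈-tabulate⁻ : ∀ {k} {E : Fin k → Bool} {e} → e Sub.∈ tabulate E → E e ≡ true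
∈-tabulate⁻ {E = E} {e} p = trans (sym (lookup∘tabulate E e)) ([]=⇒lookup p)

members : ∀ {k} → (Fin k → Bool) → List (Fin k)
members {k} E = filter (λ e → E e ≟ᵇ true) (allFin k)

length-members : ∀ {k} (E : Fin k → Bool) → length (members E) ≡ size E
length-members E = trans (length-filter-tabulate (λ e → E e ≟ᵇ true) id)
  (sum-cong-≗ λ e → cong χ (does-≟-true (E e)))
  where
  does-≟-true : ∀ x → does (x ≟ᵇ true) ≡ x
  does-≟-true true  = refl
  does-≟-true false = refl

∈-members : ∀ {k} (E : Fin k → Bool) {e} → E e ≡ true → e ∈ members E
∈-members E {e} e∈E = ∈-filter⁺ (λ e → E e ≟ᵇ true) (∈-allFin e) e∈E

-- Connectivity through a set of edges

module Connectivity (G : Graph) where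

  V Edge : Set
  V    = Fin (n G)
  Edge = Fin (m G)

  Edges : Set
  Edges = Edge → Bool

  src tgt : Edge → V
  src e = proj₁ (ends G e)
  tgt e = proj₂ (ends G e)

  -- One direction suffices, since `Conn` is the equivalence closure. A connection can then be
  -- eliminated into any equivalence relation by checking single edges, without handling walks.
  data Adj (E : Edges) : V → V → Set where
    link : ∀ e → E e ≡ true → Adj E (src e) (tgt e)

  Conn : Edges → V → V → Set
  Conn E = EqClosure (Adj E)

  Conn-isEquivalence : ∀ E → IsEquivalence (Conn E)
  Conn-isEquivalence E = EqC.isEquivalence (Adj E)

  module _ {E : Edges} where
    open IsEquivalence (Conn-isEquivalence E) public
      using () renaming (refl to ~-refl; sym to ~-sym; trans to ~-trans)

  edge : ∀ {E : Edges} e → E e ≡ true → Conn E (src e) (tgt e)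
  edge e e∈E = EqC.return (link e e∈E)

  Conn-elim : ∀ {E} {_≈_ : V → V → Set} → IsEquivalence _≈_ →
    (∀ e → E e ≡ true → src e ≈ tgt e) → ∀ {u v} → Conn E u v → u ≈ v
  Conn-elim eq f = EqC.fold eq λ { (link e e∈E) → f e e∈E }

  Spans : Edges → Edges → Set
  Spans D E = ∀ e → E e ≡ true → Conn D (src e) (tgt e)

  Conn-spans : ∀ {D E} → Spans D E → ∀ {u v} → Conn E u v → Conn D u v
  Conn-spans {D} = Conn-elim (Conn-isEquivalence D)

  ⊑⇒spans : ∀ {D E} → E ⊑ D → Spans D E
  ⊑⇒spans E⊑D e e∈E = edge e (E⊑D e e∈E)

  Conn-mono : ∀ {D E} → E ⊑ D → ∀ {u v} → Conn E u v → Conn D u v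
  Conn-mono E⊑D = Conn-spans (⊑⇒spans E⊑D)

  Conn-empty : ∀ {E} → (∀ e → E e ≢ true) → ∀ {u v} → Conn E u v → u ≡ v
  Conn-empty none = Conn-elim Eq.isEquivalence λ e e∈E → ⊥-elim (none e e∈E)

  data Split (D : Edges) (e : Edge) (u v : V) : Set where
    avoids    : Conn D u v → Split D e u v
    forwards  : Conn D u (src e) → Conn D (tgt e) v → Split D e u v
    backwards : Conn D u (tgt e) → Conn D (src e) v → Split D e u v

  -- Two successive crossings of `e` combine into at most one, which gives transitivity; `Conn-elim`
  -- then reduces `split` to single edges.
  Split-isEquivalence : ∀ D e → IsEquivalence (Split D e)
  Split-isEquivalence D e = record { refl = avoids ~-refl ; sym = sym′ ; trans = trans′ }
    where
    sym′ : ∀ {u v} → Split D e u v → Split D e v u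
    sym′ (avoids p)      = avoids (~-sym p)
    sym′ (forwards p q)  = backwards (~-sym q) (~-sym p)
    sym′ (backwards p q) = forwards (~-sym q) (~-sym p)

    trans′ : ∀ {u v w} → Split D e u v → Split D e v w → Split D e u w
    trans′ (avoids p)      (avoids r)      = avoids (~-trans p r)
    trans′ (avoids p)      (forwards r s)  = forwards (~-trans p r) s
    trans′ (avoids p)      (backwards r s) = backwards (~-trans p r) s
    trans′ (forwards p q)  (avoids r)      = forwards p (~-trans q r)
    trans′ (forwards p q)  (forwards r s)  = forwards p s
    trans′ (forwards p q)  (backwards r s) = avoids (~-trans p s)
    trans′ (backwards p q) (avoids r)      = backwards p (~-trans q r)
    trans′ (backwards p q) (forwards r s)  = avoids (~-trans p s)
    trans′ (backwards p q) (backwards r s) = backwards p s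

  split : ∀ {D E} e → (∀ h → E h ≡ true → h ≢ e → D h ≡ true) → ∀ {u v} → Conn E u v → Split D e u v
  split {D} {E} e E⊑D+e = Conn-elim (Split-isEquivalence D e) step
    where
    step : ∀ h → E h ≡ true → Split D e (src h) (tgt h)
    step h h∈E with h ≟ e
    ... | yes refl = forwards ~-refl ~-refl
    ... | no h≢e   = avoids (edge h (E⊑D+e h h∈E h≢e))

  split-∖ : ∀ {E} e {u v} → Conn E u v → Split (E ∖ e) e u v
  split-∖ {E} e = split e λ h h∈E h≢e → ∈-∖ E e h∈E (h≢e ∘ sym)

  unsplit : ∀ {E} e → E e ≡ true → ∀ {u v} → Split (E ∖ e) e u v → Conn E u v
  unsplit {E} e e∈E = λ where
      (avoids p)      → up p
      (forwards p q)  → ~-trans (up p) (~-trans (edge e e∈E) (up q))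
      (backwards p q) → ~-trans (up p) (~-trans (~-sym (edge e e∈E)) (up q))
    where
    up : ∀ {u v} → Conn (E ∖ e) u v → Conn E u v
    up = Conn-mono λ h → ∖-⊑ E e

  -- Deleting an edge `e` turns the question into the finitely many questions about the smaller set
  -- that make up `Split`.
  conn? : ∀ E u v → Dec (Conn E u v)
  conn? = removal-induction (λ E → ∀ u v → Dec (Conn E u v))
    (λ E none u v → map′ (λ { refl → ~-refl }) (Conn-empty none) (u ≟ v))
    (λ E e e∈E _~?_ u v → map′ (unsplit e e∈E ∘ to) (from ∘ split-∖ e)
      ((u ~? v) ⊎-dec ((u ~? src e) ×-dec (tgt e ~? v)) ⊎-dec ((u ~? tgt e) ×-dec (src e ~? v))))
    where
    to : ∀ {D e u v} → Conn D u v ⊎ (Conn D u (src e) × Conn D (tgt e) v) ⊎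
      (Conn D u (tgt e) × Conn D (src e) v) → Split D e u v
    to (inj₁ p)              = avoids p
    to (inj₂ (inj₁ (p , q))) = forwards p q
    to (inj₂ (inj₂ (p , q))) = backwards p q
    from : ∀ {D e u v} → Split D e u v → Conn D u v ⊎ (Conn D u (src e) × Conn D (tgt e) v) ⊎
      (Conn D u (tgt e) × Conn D (src e) v)
    from (avoids p)      = inj₁ p
    from (forwards p q)  = inj₂ (inj₁ (p , q))
    from (backwards p q) = inj₂ (inj₂ (p , q))

  -- Cardinality bounds for spanning and for independent edge sets

  Covers : Edges → List V → Set
  Covers E L = ∀ v → Any (Conn E v) L

  -- Deleting `e` breaks at most one component in two. `L` still meets the part of one end of `e`,
  -- so adding the other end to `L` restores the covering, and the total of the two sizes is
  -- unchanged. With no edges left, every vertex is in `L`.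
  covers⇒≤ : ∀ E L → Covers E L → n G ≤ size E + length L
  covers⇒≤ = removal-induction (λ E → ∀ L → Covers E L → n G ≤ size E + length L) base step
    where
    base : ∀ E → (∀ e → E e ≢ true) → ∀ L → Covers E L → n G ≤ size E + length L
    base E none L cover = ≤-trans (injective⇒≤ {f = index ∘ cover} inj) (m≤n+m _ _)
      where
      at : ∀ v → v ≡ lookup L (index (cover v))
      at v = Conn-empty none (lookup-index (cover v))
      inj : ∀ {u v} → index (cover u) ≡ index (cover v) → u ≡ v
      inj {u} {v} eq = trans (at u) (trans (cong (lookup L) eq) (sym (at v)))

    step : ∀ E e → E e ≡ true → (∀ L → Covers (E ∖ e) L → n G ≤ size (E ∖ e) + length L) →
      ∀ L → Covers E L → n G ≤ size E + length L
    step E e e∈E ih L cover = subst (n G ≤_) eq (≤-from-either reaches)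
      where
      eq : size (E ∖ e) + suc (length L) ≡ size E + length L
      eq = trans (sym (+-assoc (size (E ∖ e)) 1 (length L))) (cong (_+ length L) (size-∖ E e∈E))

      reaches : Any (Conn (E ∖ e) (src e)) L ⊎ Any (Conn (E ∖ e) (tgt e)) L
      reaches with find (cover (src e))
      ... | l , l∈L , p with split-∖ e p
      ...   | avoids q      = inj₁ (lose l∈L q)
      ...   | forwards _ q  = inj₂ (lose l∈L q)
      ...   | backwards _ q = inj₁ (lose l∈L q)

      via : ∀ {x v} → Conn (E ∖ e) v x → Any (Conn (E ∖ e) x) L → Any (Conn (E ∖ e) v) L
      via p = Any.map (~-trans p)

      ≤-from-either : Any (Conn (E ∖ e) (src e)) L ⊎ Any (Conn (E ∖ e) (tgt e)) L →
        n G ≤ size (E ∖ e) + suc (length L)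
      ≤-from-either (inj₁ r) = ih (tgt e ∷ L) λ v → case v
        where
        case : ∀ v → Any (Conn (E ∖ e) v) (tgt e ∷ L)
        case v with find (cover v)
        ... | l , l∈L , p with split-∖ e p
        ...   | avoids q      = there (lose l∈L q)
        ...   | forwards q _  = there (via q r)
        ...   | backwards q _ = here q
      ≤-from-either (inj₂ r) = ih (src e ∷ L) λ v → case v
        where
        case : ∀ v → Any (Conn (E ∖ e) v) (src e ∷ L)
        case v with find (cover v)
        ... | l , l∈L , p with split-∖ e p
        ...   | avoids q      = there (lose l∈L q)
        ...   | forwards q _  = here q
        ...   | backwards q _ = there (via q r)

  -- A forest as a set in which every edge is a bridge, a form suited to deletion. `Acyc⇒Acyclic`
  -- and `Acyclic⇒Acyc` link it to closed trails.
  Acyc : Edges → Set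
  Acyc E = ∀ e → E e ≡ true → ¬ Conn (E ∖ e) (src e) (tgt e)

  ∖-mono : ∀ {D E : Edges} e → D ⊑ E → D ∖ e ⊑ E ∖ e
  ∖-mono {D} {E} e D⊑E h p = ∧-true (D⊑E h (∖-⊑ D e p)) (∧-trueʳ {D h} p)

  Acyc-⊑ : ∀ {D E} → D ⊑ E → Acyc E → Acyc D
  Acyc-⊑ D⊑E acyc e e∈D p = acyc e (D⊑E e e∈D) (Conn-mono (∖-mono e D⊑E) p)

  Separated : Edges → List V → Set
  Separated E = AllPairs λ u v → ¬ Conn E u v

  -- Removing e splits a component into two, at most one of which contains a member of L;
  -- an end of e in the other one extends L.
  separated⇒≤ : ∀ E → Acyc E → ∀ L → Separated E L → size E + length L ≤ n G
  separated⇒≤ = removal-induction (λ E → Acyc E → ∀ L → Separated E L → size E + length L ≤ n G) base step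
    where
    base : ∀ E → (∀ e → E e ≢ true) → Acyc E → ∀ L → Separated E L → size E + length L ≤ n G
    base E none _ L sep =
      subst (λ z → z + length L ≤ n G) (sym size≡0) 
        (injective⇒≤ (apart⇒lookup-injective ~-sym sep ∘ λ eq → subst (Conn E _) eq ~-refl))
      where
      size≡0 : size E ≡ 0
      size≡0 = trans (sum-cong-≗ λ e → χ-false (none e)) (sum-replicate-zero (m G))

    step : ∀ E e → E e ≡ true → (Acyc (E ∖ e) → ∀ L → Separated (E ∖ e) L → size (E ∖ e) + length L ≤ n G) →
      Acyc E → ∀ L → Separated E L → size E + length L ≤ n G
    step E e e∈E ih acyc L sep = subst (_≤ n G) eq (extend (Any.any? (λ l → conn? (E ∖ e) (src e) l) L))
      where
      eq : size (E ∖ e) + suc (length L) ≡ size E + length L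
      eq = trans (sym (+-assoc (size (E ∖ e)) 1 (length L))) (cong (_+ length L) (size-∖ E e∈E))

      up : ∀ {u v} → Conn (E ∖ e) u v → Conn E u v
      up = Conn-mono λ h → ∖-⊑ E e

      sep′ : Separated (E ∖ e) L
      sep′ = AllPairs.map (_∘ up) sep

      ih′ : ∀ x → (∀ {l} → l ∈ L → ¬ Conn (E ∖ e) x l) → size (E ∖ e) + suc (length L) ≤ n G
      ih′ x apart = ih (Acyc-⊑ (λ h → ∖-⊑ E e) acyc) (x ∷ L) (All.tabulate apart ∷ sep′)

      extend : Dec (Any (Conn (E ∖ e) (src e)) L) → size (E ∖ e) + suc (length L) ≤ n G
      extend (no none) = ih′ (src e) λ l∈L p → none (lose l∈L p)
      extend (yes some) with find some
      ... | l , l∈L , p = ih′ (tgt e) λ l′∈L q →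
        let l~l′ = ~-trans (~-sym (up p)) (~-trans (edge e e∈E) (up q))
            l≡l′ = apart⇒≡ ~-sym sep l∈L l′∈L l~l′
        in acyc e e∈E (~-trans p (subst (λ z → Conn (E ∖ e) z (tgt e)) (sym l≡l′) (~-sym q)))

  -- Walks

  joins-sym : ∀ {e u w} → Joins G e u w → Joins G e w u
  joins-sym (inj₁ p) = inj₂ p
  joins-sym (inj₂ p) = inj₁ p

  joins-unique : ∀ {e u w x y} → Joins G e u w → Joins G e x y → (u ≡ x × w ≡ y) ⊎ (u ≡ y × w ≡ x)
  joins-unique (inj₁ refl) (inj₁ refl) = inj₁ (refl , refl)
  joins-unique (inj₁ refl) (inj₂ refl) = inj₂ (refl , refl)
  joins-unique (inj₂ refl) (inj₁ refl) = inj₂ (refl , refl)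
  joins-unique (inj₂ refl) (inj₂ refl) = inj₁ (refl , refl)

  edge-joins : ∀ {E : Edges} {e u w} → E e ≡ true → Joins G e u w → Conn E u w
  edge-joins {e = e} e∈E (inj₁ refl) = edge e e∈E
  edge-joins {e = e} e∈E (inj₂ refl) = ~-sym (edge e e∈E)

  module _ {U : Subset (n G)} {E : Subset (m G)} where

    start∈ : ∀ {u v es} → Walk G U E u v es → u Sub.∈ U
    start∈ (nil u∈U)          = u∈U
    start∈ (cons _ _ _ u∈U _) = u∈U

    _++ʷ_ : ∀ {u v w es fs} → Walk G U E u v es → Walk G U E v w fs → Walk G U E u w (es ++ fs)
    nil _              ++ʷ q = q
    cons e e∈E j u∈U p ++ʷ q = cons e e∈E j u∈U (p ++ʷ q)

    reverseʷ : ∀ {u v es} → Walk G U E u v es → Connected G U E v u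
    reverseʷ (nil u∈U) = [] , nil u∈U
    reverseʷ (cons e e∈E j u∈U p) =
      _ , proj₂ (reverseʷ p) ++ʷ cons e e∈E (joins-sym j) (start∈ p) (nil u∈U)

    Walk⇒Conn : ∀ {D} → (∀ e → e Sub.∈ E → src e Sub.∈ U → tgt e Sub.∈ U → D e ≡ true) →
      ∀ {u v es} → Walk G U E u v es → Conn D u v
    Walk⇒Conn D⊇ (nil _) = ~-refl
    Walk⇒Conn D⊇ (cons e e∈E j u∈U p) = ~-trans (edge-joins (e∈D j u∈U (start∈ p)) j) (Walk⇒Conn D⊇ p)
      where
      e∈D : ∀ {u w} → Joins G e u w → u Sub.∈ U → w Sub.∈ U → _
      e∈D (inj₁ refl) u∈U w∈U = D⊇ e e∈E u∈U w∈U
      e∈D (inj₂ refl) u∈U w∈U = D⊇ e e∈E w∈U u∈U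

    Conn⇒Connected : ∀ {D} → (∀ e → D e ≡ true → e Sub.∈ E × src e Sub.∈ U × tgt e Sub.∈ U) →
      ∀ {u v} → u Sub.∈ U → Conn D u v → Connected G U E u v
    Conn⇒Connected {D} D⊆ u∈U p with Conn-elim equiv (λ e e∈D → inj₂ (step e e∈D)) p
      where
      step : ∀ e → D e ≡ true → Connected G U E (src e) (tgt e)
      step e e∈D with D⊆ e e∈D
      ... | e∈E , s∈U , t∈U = _ , cons e e∈E (inj₁ refl) s∈U (nil t∈U)
      -- Equality is adjoined because a vertex outside `U` has no empty walk, so `Connected` alone
      -- is not reflexive.
      equiv : IsEquivalence (λ u v → u ≡ v ⊎ Connected G U E u v)
      equiv = record
        { refl  = inj₁ refl
        ; sym   = λ { (inj₁ eq) → inj₁ (sym eq) ; (inj₂ (_ , p)) → inj₂ (reverseʷ p) }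
        ; trans = λ { (inj₁ refl) q → q ; (inj₂ p) (inj₁ refl) → inj₂ p
                    ; (inj₂ (_ , p)) (inj₂ (_ , q)) → inj₂ (_ , p ++ʷ q) }
        }
    ... | inj₁ refl = _ , nil u∈U
    ... | inj₂ q    = q

    Trail : V → V → Set
    Trail u v = Σ (List Edge) λ es → Walk G U E u v es × Unique es

    -- The tail of a trail from one of its edges on starts at either end of that edge.
    trail-from-edge : ∀ {e u w v es} → Joins G e u w → u Sub.∈ U → ∀ {x} → Walk G U E x v es → Unique es →
      e ∈ es → Trail u v
    trail-from-edge j u∈U (cons _ e∈E k x∈U p) (e∉es ∷ unique) (here refl) with joins-unique j k
    ... | inj₁ (refl , refl) = _ , cons _ e∈E k x∈U p , e∉es ∷ unique
    ... | inj₂ (refl , refl) = _ , p , unique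
    trail-from-edge j u∈U (cons _ _ _ _ p) (_ ∷ unique) (there e∈es) = trail-from-edge j u∈U p unique e∈es

    -- If the first edge recurs in the trail found for the rest, the walk is cut short at that
    -- occurrence; otherwise the edge is prepended.
    trail : ∀ {u v es} → Walk G U E u v es → Trail u v
    trail (nil u∈U) = [] , nil u∈U , []
    trail (cons e e∈E j u∈U p) with trail p
    ... | es , q , unique with Any.any? (e ≟_) es
    ...   | yes e∈es = trail-from-edge j u∈U q unique e∈es
    ...   | no e∉es  = e ∷ es , cons e e∈E j u∈U q ,
      All.tabulate (λ f∈es e≡f → e∉es (Any.map (λ { refl → e≡f }) f∈es)) ∷ unique

  -- In a nonempty closed trail the edges after the first avoid it and connect its ends, so the
  -- first edge is not a bridge.
  Acyc⇒Acyclic : ∀ {E} → Acyc E → Acyclic G (tabulate E)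
  Acyc⇒Acyclic acyc v [] _ _ = refl
  Acyc⇒Acyclic {E} acyc v (e ∷ es) (cons .e e∈E j _ p) (e∉es ∷ _) =
    contradiction (joined j (avoiding p e∉es)) (acyc e (∈-tabulate⁻ e∈E))
    where
    avoiding : ∀ {x y es} → Walk G Sub.⊤ (tabulate E) x y es → All (e ≢_) es → Conn (E ∖ e) x y
    avoiding (nil _) _ = ~-refl
    avoiding (cons h h∈E k _ q) (e≢h ∷ e∉es) =
      ~-trans (edge-joins (∈-∖ E e (∈-tabulate⁻ h∈E) e≢h) k) (avoiding q e∉es)
    joined : ∀ {w} → Joins G e v w → Conn (E ∖ e) w v → Conn (E ∖ e) (src e) (tgt e)
    joined (inj₁ refl) q = ~-sym q
    joined (inj₂ refl) q = q

  -- A connection between the ends of `e` that avoids `e` yields a trail, and `e` closes it to a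
  -- nonempty closed trail in `F`.
  Acyclic⇒Acyc : ∀ {F} → Acyclic G F → Acyc (Vec.lookup F)
  Acyclic⇒Acyc {F} acyclic e e∈F p
    with trail (proj₂ (Conn⇒Connected {U = Sub.⊤} {E = tabulate (Vec.lookup F ∖ e)}
           (λ h h∈ → ∈-tabulate⁺ h∈ , ∈⊤ , ∈⊤) ∈⊤ (~-sym p)))
  ... | es , q , unique
    with acyclic (src e) (e ∷ es) (cons e (lookup⇒[]= e F e∈F) (inj₁ refl) ∈⊤ (relabel q)) (avoided q ∷ unique)
    where
    relabel : ∀ {x y es} → Walk G Sub.⊤ (tabulate (Vec.lookup F ∖ e)) x y es → Walk G Sub.⊤ F x y es
    relabel (nil v∈) = nil v∈
    relabel (cons h h∈ k v∈ q) =
      cons h (lookup⇒[]= h F (∖-⊑ (Vec.lookup F) e (∈-tabulate⁻ h∈))) k v∈ (relabel q)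
    avoided : ∀ {x y es} → Walk G Sub.⊤ (tabulate (Vec.lookup F ∖ e)) x y es → All (e ≢_) es
    avoided (nil _) = []
    avoided (cons h h∈ _ _ q) = (λ { refl → ∉-∖ (Vec.lookup F) e (∈-tabulate⁻ h∈) }) ∷ avoided q
  ...   | ()

  -- Spanning trees

  record Tree (T : Edges) : Set where
    field
      acyc      : Acyc T
      connected : ∀ u v → Conn T u v

  tree-size : ∀ {T} → Tree T → V → size T < n G
  tree-size {T} tree v = subst (_≤ n G) (+-comm (size T) 1)
    (separated⇒≤ T (Tree.acyc tree) (v ∷ []) ([] ∷ []))

  -- If an edge of `E` were not a bridge, deleting it would leave a connected set, which by
  -- `covers⇒≤` needs at least `n G - 1` edges; but `E` itself has no more than that.
  connected⇒tree : ∀ {T E} → Tree T → (∀ u v → Conn E u v) → size E ≤ size T → Tree E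
  connected⇒tree {T} {E} tree conn E≤T = record { connected = conn ; acyc = acyc }
    where
    acyc : Acyc E
    acyc e e∈E p = <-irrefl refl (<-≤-trans (tree-size tree (src e)) (begin
      n G                                  ≤⟨ covers⇒≤ (E ∖ e) (src e ∷ []) (λ v → here (Conn-spans spans (conn v (src e)))) ⟩
      size (E ∖ e) + 1                     ≡⟨ size-∖ E e∈E ⟩
      size E                               ≤⟨ E≤T ⟩
      size T                               ∎))
      where
      open ≤-Reasoning
      spans : Spans (E ∖ e) E
      spans h h∈E with e ≟ h
      ... | yes refl = p
      ... | no e≢h   = edge h (∈-∖ E e h∈E e≢h)

  infixl 6 _⊕_

  _⊕_ : Edges → Edge → Edges
  E ⊕ g = E ∪ δ g

  ⊕-⊑ : ∀ E g → E ⊑ E ⊕ g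
  ⊕-⊑ E g = ∪-⊑ˡ E (δ g)

  ∈-⊕ : ∀ E g → (E ⊕ g) g ≡ true
  ∈-⊕ E g = ∪-⊑ʳ E (δ g) g (δ-refl g)

  ⊕-≢ : ∀ E g {h} → (E ⊕ g) h ≡ true → g ≢ h → E h ≡ true
  ⊕-≢ E g {h} p g≢h = trans (sym (trans (cong (E h ∨_) (dec-false (g ≟ h) g≢h)) (∨-identityʳ (E h)))) p

  -- If the ends of `e` stay connected after its deletion, the connection either avoids `g` and
  -- contradicts `acyc`, or passes through `g`; then its remaining pieces together with `e` join the
  -- ends of `g` inside `E`.
  Acyc-⊕ : ∀ {E g} → Acyc E → ¬ Conn E (src g) (tgt g) → Acyc (E ⊕ g)
  Acyc-⊕ {E} {g} acyc apart e e∈ p = refute (g ≟ e)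
    where
    up : ∀ {u v} → Conn (E ∖ e) u v → Conn E u v
    up = Conn-mono λ h → ∖-⊑ E e

    D⊑E+g : ∀ h → (E ⊕ g ∖ e) h ≡ true → h ≢ g → E h ≡ true
    D⊑E+g h h∈ h≢g = ⊕-≢ E g (∖-⊑ (E ⊕ g) e h∈) (h≢g ∘ sym)

    refute : Dec (g ≡ e) → ⊥
    refute (yes refl) = apart (Conn-mono (λ h h∈ → D⊑E+g h h∈ λ { refl → ∉-∖ (E ⊕ g) g h∈ }) p)
    refute (no g≢e)
      with ⊕-≢ E g e∈ g≢e
         | split g (λ h h∈ h≢g → ∈-∖ E e (D⊑E+g h h∈ h≢g) λ { refl → ∉-∖ (E ⊕ g) e h∈ }) p
    ... | e∈E | avoids q      = acyc e e∈E q
    ... | e∈E | forwards q r  = apart (~-trans (~-sym (up q)) (~-trans (edge e e∈E) (~-sym (up r))))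
    ... | e∈E | backwards q r = apart (~-trans (up r) (~-trans (~-sym (edge e e∈E)) (up q)))

  -- Greedy construction: an edge is added exactly when its ends are not yet connected.
  extend-forest : ∀ (es : List Edge) {E} → Acyc E →
    Σ Edges λ T → E ⊑ T × Acyc T × All (λ g → Conn T (src g) (tgt g)) es
  extend-forest [] {E} acyc = E , (λ _ → id) , acyc , []
  extend-forest (g ∷ es) {E} acyc with conn? E (src g) (tgt g)
  ... | yes p with extend-forest es acyc
  ...   | T , E⊑T , acycT , conn = T , E⊑T , acycT , Conn-mono E⊑T p ∷ conn
  extend-forest (g ∷ es) {E} acyc | no ¬p with extend-forest es (Acyc-⊕ acyc ¬p)
  ...   | T , E⊕g⊑T , acycT , conn =
    T , (λ e → E⊕g⊑T e ∘ ⊕-⊑ E g e) , acycT , edge g (E⊕g⊑T g (∈-⊕ E g)) ∷ conn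

  forest⇒tree : IsConnected G → ∀ {F} → Acyc F → Σ Edges λ T → F ⊑ T × Tree T
  forest⇒tree G-connected acyc with extend-forest (allFin (m G)) acyc
  ... | T , F⊑T , acycT , conn = T , F⊑T , record
    { acyc = acycT
    ; connected = λ u v → Conn-spans {E = const true} (λ e _ → All.lookup conn (∈-allFin e))
                            (Walk⇒Conn (λ _ _ _ _ → refl) (proj₂ (G-connected u v)))
    }

  -- Components of G ∖ S

  module _ (S : V → Bool) where

    outer : Edges
    outer e = not (S (src e)) ∧ not (S (tgt e))

    -- When `vs` lists all vertices, `L` has one vertex in each component of the graph left after
    -- deleting `S`, so its length is the number of components. The parameter `vs` serves the
    -- recursion that builds `L`.
    record Representatives (vs L : List V) : Set where
      field
        outside   : All (λ v → S v ≡ false) L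
        separated : Separated outer L
        covering  : ∀ {v} → v ∈ vs → S v ≡ false → Any (Conn outer v) L

    representatives : ∀ vs → ∃ (Representatives vs)
    representatives [] = [] , record { outside = [] ; separated = [] ; covering = λ () }
    representatives (v ∷ vs) with representatives vs
    ... | L , R with S v ≟ᵇ true | Any.any? (conn? outer v) L
    ...   | yes v∈S | _ = L , record
      { Representatives R
      ; covering = λ { (here refl) v∉S → contradiction v∈S (not-¬ v∉S) ; (there u∈) → Representatives.covering R u∈ } }
    ...   | no v∉S | yes p = L , record
      { Representatives R
      ; covering = λ { (here refl) _ → p ; (there u∈) → Representatives.covering R u∈ } }
    ...   | no v∉S | no ¬p = v ∷ L , record
      { outside   = ¬-not v∉S ∷ Representatives.outside R
      ; separated = All.tabulate (λ u∈L q → ¬p (lose u∈L q)) ∷ Representatives.separated R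
      ; covering  = λ { (here refl) _ → here ~-refl ; (there u∈) → there ∘ Representatives.covering R u∈ } }

    ∉⇒outside : ∀ {v} → v Sub.∉ tabulate S → S v ≡ false
    ∉⇒outside v∉S = ¬-not (v∉S ∘ ∈-tabulate⁺)

    outside⇒∉ : ∀ {v} → S v ≡ false → v Sub.∉ tabulate S
    outside⇒∉ p v∈S = not-¬ p (∈-tabulate⁻ v∈S)

    -- A vertex is labelled by the position of its representative in `L`. This makes the hypothesis
    -- on component counts applicable with `k` the length of `L`.
    components : ∀ {L} → Representatives (allFin (n G)) L → HasComponents G (tabulate S) (length L)
    components {L} R = label , surjective , λ x y → labelled x y , same-label x y
      where
      open Representatives R
      VO = VertOut G (tabulate S)

      home : (x : VO) → Any (Conn outer (proj₁ x)) L
      home (v , v∉S) = covering (∈-allFin v) (∉⇒outside v∉S)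

      label : VO → Fin (length L)
      label = index ∘ home

      to-label : ∀ x → Conn outer (proj₁ x) (lookup L (label x))
      to-label x = lookup-index (home x)

      surjective : Surjective _≡_ _≡_ label
      surjective i = rep , λ { refl → apart⇒lookup-injective ~-sym separated (~-sym (to-label rep)) }
        where
        rep : VO
        rep = lookup L i , outside⇒∉ (All.lookup outside (∈-lookup i))

      labelled : ∀ x y → label x ≡ label y → Connected G (Sub.∁ (tabulate S)) Sub.⊤ (proj₁ x) (proj₁ y)
      labelled x y eq = Conn⇒Connected
        (λ e e∈ → ∈⊤ , x∉p⇒x∈∁p (outside⇒∉ (not-true (∧-trueˡ e∈)))
                     , x∉p⇒x∈∁p (outside⇒∉ (not-true (∧-trueʳ {not (S (src e))} e∈))))
        (x∉p⇒x∈∁p (proj₂ x))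
        (~-trans (to-label x) (subst (λ i → Conn outer (lookup L i) (proj₁ y)) (sym eq) (~-sym (to-label y))))

      same-label : ∀ x y → Connected G (Sub.∁ (tabulate S)) Sub.⊤ (proj₁ x) (proj₁ y) → label x ≡ label y
      same-label x y (_ , p) = apart⇒lookup-injective ~-sym separated
        (~-trans (~-sym (to-label x)) (~-trans (Walk⇒Conn inner p) (to-label y)))
        where
        inner : ∀ e → e Sub.∈ Sub.⊤ → src e Sub.∈ Sub.∁ (tabulate S) → tgt e Sub.∈ Sub.∁ (tabulate S) →
          outer e ≡ true
        inner e _ s∉S t∉S = ∧-true (cong not (∉⇒outside (x∈∁p⇒x∉p s∉S))) (cong not (∉⇒outside (x∈∁p⇒x∉p t∉S)))

  -- Degrees

  -- A sum instead of a disjunction keeps `degree` linear, as double counting requires. Looplessness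
  -- makes it agree with `deg`.
  inc : V → Edge → ℕ
  inc v e = χ (δ v (src e)) + χ (δ v (tgt e))

  degree : Edges → V → ℕ
  degree E v = ⟦ E ⟧ · inc v

  deg≡degree : ∀ E v → deg G E v ≡ degree (Vec.lookup E) v
  deg≡degree E v = trans
    (length-filter-tabulate (λ e → (e ∈? E) ×-dec ((v ≟ src e) ⊎-dec (v ≟ tgt e))) id)
    (sum-cong-≗ pointwise)
    where
    pointwise : ∀ e → χ (does (e ∈? E) ∧ (δ v (src e) ∨ δ v (tgt e))) ≡ χ (Vec.lookup E e) * inc v e
    pointwise e with Vec.lookup E e in eq
    ... | false rewrite dec-false (e ∈? E) (λ p → not-¬ eq ([]=⇒lookup p)) = refl
    ... | true rewrite dec-true (e ∈? E) (lookup⇒[]= e E eq) with v ≟ src e | v ≟ tgt e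
    ...   | yes refl | yes v≡t = contradiction v≡t (loopless G e)
    ...   | yes refl | no _  = refl
    ...   | no _     | yes _ = refl
    ...   | no _     | no _  = refl

  -- Double counting: after exchanging the sums, each edge contributes the number of its ends in
  -- `S`.
  degree-handshake : ∀ S E → ⟦ S ⟧ · degree E ≡ ⟦ E ⟧ · (λ e → χ (S (src e)) + χ (S (tgt e)))
  degree-handshake S E = begin
    sum (λ v → χ (S v) * sum (λ e → χ (E e) * inc v e))   ≡⟨ sum-cong-≗ (λ v → *-distribˡ-sum (χ (S v)) λ e → χ (E e) * inc v e) ⟩
    sum (λ v → sum (λ e → χ (S v) * (χ (E e) * inc v e))) ≡⟨ ∑-comm (λ v e → χ (S v) * (χ (E e) * inc v e)) ⟩
    sum (λ e → sum (λ v → χ (S v) * (χ (E e) * inc v e))) ≡⟨ sum-cong-≗ (λ e → sum-cong-≗ λ v → swap (χ (S v)) (χ (E e)) (inc v e)) ⟩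
    sum (λ e → sum (λ v → χ (E e) * (inc v e * χ (S v)))) ≡⟨ sum-cong-≗ (λ e → *-distribˡ-sum (χ (E e)) λ v → inc v e * χ (S v)) ⟨
    sum (λ e → χ (E e) * sum (λ v → inc v e * χ (S v)))   ≡⟨ sum-cong-≗ (λ e → cong (χ (E e) *_) (ends-sum e)) ⟩
    sum (λ e → χ (E e) * (χ (S (src e)) + χ (S (tgt e)))) ∎
    where
    open ≡-Reasoning
    swap : ∀ a b c → a * (b * c) ≡ b * (c * a)
    swap = solve-∀
    at : ∀ u → (λ v → χ (δ v u)) · ⟦ S ⟧ ≡ χ (S u)
    at u = trans (sum-cong-≗ λ v → cong (λ z → χ z * χ (S v)) (δ-sym v u)) (⟦δ⟧-· u ⟦ S ⟧)
    ends-sum : ∀ e → (λ v → inc v e) · ⟦ S ⟧ ≡ χ (S (src e)) + χ (S (tgt e))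
    ends-sum e = trans (·-+ (λ v → χ (δ v (src e))) _ ⟦ S ⟧) (cong₂ _+_ (at (src e)) (at (tgt e)))

  degree-zero : ∀ E v → (∀ e → E e ≡ true → v ≢ src e × v ≢ tgt e) → degree E v ≡ 0
  degree-zero E v none = trans (sum-cong-≗ pointwise) (sum-replicate-zero (m G))
    where
    pointwise : ∀ e → χ (E e) * inc v e ≡ 0
    pointwise e with E e in eq
    ... | false = refl
    ... | true rewrite χ-δ-≢ (proj₁ (none e eq)) | χ-δ-≢ (proj₂ (none e eq)) = refl

  -- The counting argument

  module _ (f : V → ℕ)
    (tough : ∀ (S : Subset (n G)) (k : ℕ) → HasComponents G S k →
      ℤ.+ k ℤ.≤ (sumOver G S (λ v → ℤ.+ f v ℤ.- ℤ.+ 2) ℤ.+ ℤ.+ 2)) where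

    representatives-bound : ∀ S {L} → Representatives S (allFin (n G)) L → length L + 2 * size S ≤ ⟦ S ⟧ · f + 2
    representatives-bound S {L} R = ℤₚ.drop‿+≤+ (begin
      ℤ.+ length L ℤ.+ ℤ.+ (2 * size S)     ≤⟨ ℤₚ.+-monoˡ-≤ (ℤ.+ (2 * size S)) (tough (tabulate S) _ (components S R)) ⟩
      (s ℤ.+ ℤ.+ 2) ℤ.+ ℤ.+ (2 * size S)    ≡⟨ rearrange s (ℤ.+ (2 * size S)) ⟩
      (s ℤ.+ ℤ.+ (2 * size S)) ℤ.+ ℤ.+ 2    ≡⟨ cong (λ z → (s ℤ.+ ℤ.+ (2 * z)) ℤ.+ ℤ.+ 2) (sum-cong-≗ λ v → cong χ (∈S? v)) ⟨
      (s ℤ.+ ℤ.+ (2 * size (does ∘ (_∈? tabulate S)))) ℤ.+ ℤ.+ 2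
                                            ≡⟨ cong (ℤ._+ ℤ.+ 2) (sum-filter-tabulate (_∈? tabulate S) f id) ⟩
      ℤ.+ (⟦ does ∘ (_∈? tabulate S) ⟧ · f + 2)
                                            ≡⟨ cong (λ z → ℤ.+ (z + 2)) (sum-cong-≗ λ v → cong (λ b → χ b * f v) (∈S? v)) ⟩
      ℤ.+ (⟦ S ⟧ · f + 2)                   ∎)
      where
      open ℤₚ.≤-Reasoning
      s = sumOver G (tabulate S) (λ v → ℤ.+ f v ℤ.- ℤ.+ 2)
      rearrange : ∀ s c → (s ℤ.+ ℤ.+ 2) ℤ.+ c ≡ (s ℤ.+ c) ℤ.+ ℤ.+ 2
      rearrange = ℤ-solve-∀
      ∈S? : ∀ v → does (v ∈? tabulate S) ≡ S v
      ∈S? v with S v in eq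
      ... | true  = dec-true (v ∈? tabulate S) (∈-tabulate⁺ eq)
      ... | false = dec-false (v ∈? tabulate S) (outside⇒∉ S eq)

    -- The situation in which the local search is stuck with `w` still in `S`. The term `χ (δ w v)`
    -- in `saturated` records that `w` exceeds its bound; this one unit decides the count.
    module _ {T F A : Edges} (tree : Tree T) (F⊑A : F ⊑ A) (A⊑T : A ⊑ T) (S : V → Bool)
      (cut : ∀ e → T e ≡ true → F e ≡ false → S (src e) ≡ true ⊎ S (tgt e) ≡ true → A e ≡ false)
      (w : V) (w∈S : S w ≡ true)
      (saturated : ∀ v → S v ≡ true → f v + (degree F v ∸ 1) + χ (δ w v) ≤ degree T v)
      (closed : Spans A (outer S)) where

      private
        H R within TS FS HS D : Edges
        H = T ─ F
        R = T ─ A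
        within e = S (src e) ∧ S (tgt e)
        TS e = T e ∧ within e
        FS e = F e ∧ within e
        HS e = H e ∧ within e
        D = T ─ TS

        -- The vertices of `S` where `degree F v ∸ 1` truncates. They gain a unit each in `bound-S`
        -- and pay for it as additional representatives in `bound-A`.
        S₀ : V → Bool
        S₀ v = S v ∧ does (degree F v ≟ℕ 0)

        F⊑T : F ⊑ T
        F⊑T e = A⊑T e ∘ F⊑A e

        reps : ∃ (Representatives S (allFin (n G)))
        reps = representatives S (allFin (n G))

        outside-covered : ∀ {v} → S v ≡ false →
          Any (Conn A v) (proj₁ reps ++ members S₀ ++ map src (members FS))
        outside-covered {v} v∉S =
          ++⁺ˡ (Any.map (Conn-spans closed) (Representatives.covering (proj₂ reps) (∈-allFin v) v∉S))

        within-covered : ∀ {v e} → F e ≡ true → within e ≡ true → Conn A v (src e) →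
          Any (Conn A v) (proj₁ reps ++ members S₀ ++ map src (members FS))
        within-covered e∈F e∈S p =
          ++⁺ʳ (proj₁ reps) (++⁺ʳ (members S₀) (lose (∈-map⁺ src (∈-members FS (∧-true e∈F e∈S))) p))

        -- A vertex off `S` is joined in `A` to its representative by `closed`. A vertex of `S`
        -- without an edge of `F` is in `S₀`. Any other vertex of `S` has an edge of `F` that leads
        -- off `S` or lies within `S`; in the latter case the source of that edge is listed.
        cover-A : Covers A (proj₁ reps ++ members S₀ ++ map src (members FS))
        cover-A v with S v ≟ᵇ true
        ... | no v∉S  = outside-covered (¬-not v∉S)
        ... | yes v∈S with degree F v ≟ℕ 0
        ...   | yes d≡0 = ++⁺ʳ (proj₁ reps)
                    (++⁺ˡ (lose (∈-members S₀ (∧-true v∈S (dec-true (degree F v ≟ℕ 0) d≡0))) ~-refl))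
        ...   | no d≢0 with any? (λ e → (F e ≟ᵇ true) ×-dec ((v ≟ src e) ⊎-dec (v ≟ tgt e)))
        ...     | no none = contradiction
                    (degree-zero F v λ e e∈F → (λ p → none (e , e∈F , inj₁ p)) , (λ p → none (e , e∈F , inj₂ p))) d≢0
        ...     | yes (e , e∈F , inj₁ refl) with S (tgt e) ≟ᵇ true
        ...       | yes t∈S = within-covered e∈F (∧-true v∈S t∈S) ~-refl
        ...       | no t∉S  = Any.map (~-trans (edge e (F⊑A e e∈F))) (outside-covered (¬-not t∉S))
        cover-A v | yes v∈S | no d≢0 | yes (e , e∈F , inj₂ refl) with S (src e) ≟ᵇ true
        ...       | yes s∈S = within-covered e∈F (∧-true s∈S v∈S) (~-sym (edge e (F⊑A e e∈F)))
        ...       | no s∉S  = Any.map (~-trans (~-sym (edge e (F⊑A e e∈F)))) (outside-covered (¬-not s∉S))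

        bound-A : n G ≤ size A + (length (proj₁ reps) + (size S₀ + size FS))
        bound-A = subst (λ z → n G ≤ size A + z) lengths (covers⇒≤ A _ cover-A)
          where
          lengths : length (proj₁ reps ++ members S₀ ++ map src (members FS)) ≡ length (proj₁ reps) + (size S₀ + size FS)
          lengths = trans (length-++ (proj₁ reps)) (cong (length (proj₁ reps) +_)
            (trans (length-++ (members S₀)) (cong₂ _+_ (length-members S₀)
              (trans (length-map src (members FS)) (length-members FS)))))

        -- Reaching `S` inside `D` passes along every edge of `T`: an edge missing from `D` has both
        -- ends in `S`. As `T` connects everything to `w`, each vertex reaches `S`. Together with
        -- `tree-size` this gives fewer than `size S` edges of `T` within `S`.
        cover-D : Covers D (members S)
        cover-D v = proj₁ (Conn-elim equiv step (Tree.connected tree w v)) (lose (∈-members S w∈S) ~-refl)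
          where
          Reaches : V → Set
          Reaches v = Any (Conn D v) (members S)
          equiv : IsEquivalence (λ u v → (Reaches u → Reaches v) × (Reaches v → Reaches u))
          equiv = record
            { refl  = id , id
            ; sym   = λ (p , q) → q , p
            ; trans = λ (p , q) (p′ , q′) → p′ ∘ p , q ∘ q′
            }
          step : ∀ e → T e ≡ true → (Reaches (src e) → Reaches (tgt e)) × (Reaches (tgt e) → Reaches (src e))
          step e e∈T with within e ≟ᵇ true
          ... | yes p = const (lose (∈-members S (∧-trueʳ {S (src e)} p)) ~-refl) ,
                        const (lose (∈-members S (∧-trueˡ p)) ~-refl)
          ... | no ¬p = Any.map (~-trans (~-sym e∈D)) , Any.map (~-trans e∈D)
            where
            e∈D : Conn D (src e) (tgt e)
            e∈D = edge e (∧-true e∈T (cong not (¬-not λ q → ¬p (∧-trueʳ {T e} q))))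

        bound-D : n G ≤ size D + size S
        bound-D = subst (λ z → n G ≤ size D + z) (length-members S) (covers⇒≤ D _ cover-D)

        bound-TS : size FS + size HS ≤ size TS
        bound-TS = ≤-trans (≤-reflexive (sym (∑-distrib-+ ⟦ FS ⟧ ⟦ HS ⟧))) (sum-mono pointwise)
          where
          pointwise : ∀ e → χ (FS e) + χ (HS e) ≤ χ (TS e)
          pointwise e with within e | F e in e∈F | T e in e∈T
          ... | i     | true  | false = contradiction (trans (sym (F⊑T e e∈F)) e∈T) λ ()
          ... | false | true  | true  = z≤n
          ... | true  | true  | true  = ≤-refl
          ... | false | false | true  = z≤n
          ... | true  | false | true  = ≤-refl
          ... | i     | false | false = z≤n

        -- By `cut`, an edge of `H` meeting `S` lies in `R`, which pays for one of its ends; a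
        -- second end in `S` is paid for by `HS`.
        bound-H : ⟦ S ⟧ · degree H ≤ size R + size HS
        bound-H = begin
          ⟦ S ⟧ · degree H                                ≡⟨ degree-handshake S H ⟩
          ⟦ H ⟧ · (λ e → χ (S (src e)) + χ (S (tgt e)))   ≤⟨ sum-mono pointwise ⟩
          sum (λ e → χ (R e) + χ (HS e))                  ≡⟨ ∑-distrib-+ ⟦ R ⟧ ⟦ HS ⟧ ⟩
          size R + size HS                                ∎
          where
          open ≤-Reasoning
          pointwise : ∀ e → χ (H e) * (χ (S (src e)) + χ (S (tgt e))) ≤ χ (R e) + χ (HS e)
          pointwise e with T e in e∈T | F e in e∈F
          ... | false | _    = z≤n
          ... | true  | true = z≤n
          ... | true  | false with S (src e) in s | S (tgt e) in t
          ...   | false | false = z≤n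
          ...   | true  | true  rewrite cut e e∈T e∈F (inj₁ s) = ≤-refl
          ...   | true  | false rewrite cut e e∈T e∈F (inj₁ s) = ≤-refl
          ...   | false | true  rewrite cut e e∈T e∈F (inj₂ t) = ≤-refl

        -- Sum `saturated` over `S` with the degree in `T` split into those in `F` and `H`. The
        -- difference of `d` and `d ∸ 1` is 1, except that it is 0 on `S₀`; the last unit comes from
        -- `w`.
        bound-S : ⟦ S ⟧ · f + size S₀ + 1 ≤ ⟦ S ⟧ · degree H + size S
        bound-S = begin
          ⟦ S ⟧ · f + size S₀ + 1                              ≡⟨ cong (⟦ S ⟧ · f + size S₀ +_) (size-δ w) ⟨
          ⟦ S ⟧ · f + size S₀ + size (δ w)                     ≡⟨ cong (_+ size (δ w)) (∑-distrib-+ (λ v → χ (S v) * f v) ⟦ S₀ ⟧) ⟨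
          sum (λ v → χ (S v) * f v + χ (S₀ v)) + size (δ w)    ≡⟨ ∑-distrib-+ (λ v → χ (S v) * f v + χ (S₀ v)) ⟦ δ w ⟧ ⟨
          sum (λ v → χ (S v) * f v + χ (S₀ v) + χ (δ w v))     ≤⟨ sum-mono pointwise ⟩
          sum (λ v → χ (S v) * degree H v + χ (S v))           ≡⟨ ∑-distrib-+ (λ v → χ (S v) * degree H v) ⟦ S ⟧ ⟩
          ⟦ S ⟧ · degree H + size S                            ∎
          where
          open ≤-Reasoning
          arith : ∀ φ d h x → φ + (d ∸ 1) + x ≤ d + h → 1 * φ + χ (does (d ≟ℕ 0)) + x ≤ 1 * h + 1
          arith φ zero h x p = ≤-from p (eq φ h x)
            where
            eq : ∀ φ h x → 1 * φ + 1 + x + h ≡ 1 * h + 1 + (φ + 0 + x)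
            eq = solve-∀
          arith φ (suc d) h x p = ≤-from p (eq φ h x d)
            where
            eq : ∀ φ h x d → 1 * φ + 0 + x + (suc d + h) ≡ 1 * h + 1 + (φ + d + x)
            eq = solve-∀
          pointwise : ∀ v → χ (S v) * f v + χ (S₀ v) + χ (δ w v) ≤ χ (S v) * degree H v + χ (S v)
          pointwise v with S v in v∈S
          ... | true = arith (f v) (degree F v) (degree H v) (χ (δ w v))
            (≤-trans (saturated v v∈S) (≤-reflexive (·-─ F⊑T (inc v))))
          ... | false with w ≟ v
          ...   | yes refl = contradiction (trans (sym w∈S) v∈S) λ ()
          ...   | no _     = z≤n

      closed⇒⊥ : ⊥
      closed⇒⊥ = 1+n≰n (≤-trans (≤-reflexive (sym eq)) total)
        where
        ≤T : size A + size R < n G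
        ≤T = subst (_< n G) (size-─ A⊑T) (tree-size tree w)
        ≤T′ : size TS + size D < n G
        ≤T′ = subst (_< n G) (size-─ {D = TS} {T} (λ e → ∧-trueˡ)) (tree-size tree w)
        -- All quantities cancel in the sum of the eight inequalities. Using that `T` has fewer than
        -- `n G` edges twice, and the surplus at `w`, leaves 3 on the left; the constant in the
        -- component bound leaves 2 on the right.
        total = +-mono-≤ bound-A (+-mono-≤ ≤T (+-mono-≤ ≤T′ (+-mono-≤ bound-D
          (+-mono-≤ bound-TS (+-mono-≤ bound-H (+-mono-≤ bound-S (representatives-bound S (proj₂ reps))))))))
        identity : ∀ n a r ts d fs hs x φ s₀ l s →
          n + (suc (a + r) + (suc (ts + d) + (n + (fs + hs + (x + (φ + s₀ + 1 + (l + 2 * s)))))))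
          ≡ suc (a + (l + (s₀ + fs)) + (n + (n + (d + s + (ts + (r + hs + (x + s + (φ + 2))))))))
        identity = solve-∀
        eq = identity (n G) (size A) (size R) (size TS) (size D) (size FS) (size HS) (⟦ S ⟧ · degree H)
          (⟦ S ⟧ · f) (size S₀) (length (proj₁ reps)) (size S)

  -- Exchanges

  degree-∪ : ∀ D E v → degree (D ∪ E) v ≤ degree D v + degree E v
  degree-∪ D E v = ·-∪ D E (inc v)

  inc-end : ∀ {v e} → v ≡ src e ⊎ v ≡ tgt e → 1 ≤ inc v e
  inc-end {v} (inj₁ refl) rewrite δ-refl v = s≤s z≤n
  inc-end {v} {e} (inj₂ refl) rewrite δ-refl v = m≤n+m 1 (χ (δ v (src e)))

  module Exchange {F T : Edges} (tree : Tree T) (b : V → ℕ) where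

    -- A vertex may be filled up to `b v`, but beyond that not above its present degree, so staying
    -- within `cap` never increases the excess at a vertex.
    cap : V → ℕ
    cap v = degree T v ⊔ b v

    -- At most one vertex per component of `A`: all vertices that one step frees share a component
    -- of the enlarged set, and a single trade can give slack to only one of them.
    record Transversal (A : Edges) (S U : V → Bool) : Set where
      field
        outside : ∀ {u} → U u ≡ true → S u ≡ false
        apart   : ∀ {u v} → U u ≡ true → U v ≡ true → Conn A u v → u ≡ v

    -- Replacing A by B inside T gives a tree with degrees at most cap, strictly so on U.
    record Relaxation (A : Edges) (U : V → Bool) : Set where
      field
        B       : Edges
        F⊑B     : F ⊑ B
        B≤A     : size B ≤ size A
        spans   : Spans B A
        -- Since `A ⊑ T`, this is the bound `cap v` on the degree in `B` plus that in `T ─ A` plus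
        -- the slack, with the degree in `A` added to both sides to avoid subtraction.
        degrees : ∀ v → degree B v + degree T v + χ (U v) ≤ degree A v + cap v

    record Stage (A : Edges) (S : V → Bool) : Set where
      field
        F⊑A       : F ⊑ A
        A⊑T       : A ⊑ T
        saturated : ∀ v → S v ≡ true → b v ≤ degree T v
        cut       : ∀ e → T e ≡ true → F e ≡ false → S (src e) ≡ true ⊎ S (tgt e) ≡ true → A e ≡ false
        relax     : ∀ U → Transversal A S U → Relaxation A U

    -- Off this `S` the degree in `T` is already below `b`, so the slack is there without any
    -- exchange and `B` is `F` itself.
    initial : F ⊑ T → Stage F (λ v → does (b v ≤? degree T v))
    initial F⊑T = record
      { F⊑A       = λ _ → id
      ; A⊑T       = F⊑T
      ; saturated = λ v → dec-true⁻¹ (b v ≤? degree T v)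
      ; cut       = λ _ _ e∉F _ → e∉F
      ; relax     = λ U transversal → record
        { B = F ; F⊑B = λ _ → id ; B≤A = ≤-refl ; spans = edge
        ; degrees = λ v → ≤-trans (≤-reflexive (+-assoc (degree F v) _ _))
                            (+-monoʳ-≤ (degree F v) (slack (Transversal.outside transversal) v)) }
      }
      where
      slack : ∀ {U : V → Bool} → (∀ {u} → U u ≡ true → does (b u ≤? degree T u) ≡ false) →
        ∀ v → degree T v + χ (U v) ≤ cap v
      slack {U} outside v with U v in v∈U
      ... | false = ≤-trans (≤-reflexive (+-identityʳ _)) (m≤m⊔n (degree T v) (b v))
      ... | true = ≤-trans (≤-reflexive (+-comm _ 1))
        (≤-trans (≰⇒> (dec-false⁻¹ (b v ≤? degree T v) (outside v∈U))) (m≤n⊔m (degree T v) (b v)))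

    Improved : V → Set
    Improved w = Σ Edges λ T′ → F ⊑ T′ × Tree T′ × (∀ v → degree T′ v + χ (δ w v) ≤ cap v)

    -- Relax the single vertex `w` and keep the edges of `T ─ A`. The result is connected and no
    -- larger than `T`, hence a tree.
    improve : ∀ {A S} → Stage A S → ∀ w → S w ≡ false → Improved w
    improve {A} {S} stage w w∉S = T′ , F⊑T′ , connected⇒tree tree connected T′≤T , degrees′
      where
      open Stage stage
      at : ∀ {u} → δ w u ≡ true → w ≡ u
      at {u} = dec-true⁻¹ (w ≟ u)
      transversal : Transversal A S (δ w)
      transversal = record
        { outside = λ p → subst (λ z → S z ≡ false) (at p) w∉S
        ; apart   = λ p q _ → trans (sym (at p)) (at q)
        }
      open Relaxation (relax (δ w) transversal)
      T′ : Edges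
      T′ = B ∪ (T ─ A)
      F⊑T′ : F ⊑ T′
      F⊑T′ e e∈F = ∪-⊑ˡ B (T ─ A) e (F⊑B e e∈F)
      connected : ∀ u v → Conn T′ u v
      connected u v = Conn-spans step (Tree.connected tree u v)
        where
        step : Spans T′ T
        step e e∈T with A e ≟ᵇ true
        ... | yes e∈A = Conn-mono (∪-⊑ˡ B (T ─ A)) (spans e e∈A)
        ... | no e∉A  = edge e (∪-⊑ʳ B (T ─ A) e (∧-true e∈T (cong not (¬-not e∉A))))
      T′≤T : size T′ ≤ size T
      T′≤T = begin
        size T′                 ≤⟨ size-∪ B (T ─ A) ⟩
        size B + size (T ─ A)   ≤⟨ +-monoˡ-≤ (size (T ─ A)) B≤A ⟩
        size A + size (T ─ A)   ≡⟨ size-─ A⊑T ⟨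
        size T                  ∎
        where open ≤-Reasoning
      degrees′ : ∀ v → degree T′ v + χ (δ w v) ≤ cap v
      degrees′ v = ≤-from
        (+-mono-≤ (degree-∪ B (T ─ A) v) (+-mono-≤ (≤-reflexive (sym (·-─ A⊑T (inc v)))) (degrees v)))
        (identity (degree T′ v) (degree B v) (degree (T ─ A) v) (degree A v) (degree T v) (χ (δ w v)) (cap v))
        where
        identity : ∀ t′ b r a t u c → t′ + u + (b + r + (t + (a + c))) ≡ c + (t′ + (a + r + (b + t + u)))
        identity = solve-∀

    -- If g joins two A-components off S, then A grows by a minimal P making its ends connected, and
    -- the ends of P leave S. A vertex s ∈ S on an edge e ∈ P is relaxed by trading e for g,
    -- once both ends of g have been relaxed.
    module Advance {A S} (stage : Stage A S) (g : Edge)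
      (src∉S : S (src g) ≡ false) (tgt∉S : S (tgt g) ≡ false) (g-apart : ¬ Conn A (src g) (tgt g))
      {A′ : Edges} (A⊑A′ : A ⊑ A′) (A′⊑T : A′ ⊑ T) (linked : Conn A′ (src g) (tgt g))
      (critical : ∀ e → A′ e ≡ true → A e ≢ true → ¬ Conn (A′ ∖ e) (src g) (tgt g)) where

      open Stage stage

      private
        x y : V
        x = src g
        y = tgt g

        P : Edges
        P = A′ ─ A

        P⊑A′ : P ⊑ A′
        P⊑A′ e = ∧-trueˡ

        P∌ : ∀ {e} → P e ≡ true → A e ≡ false
        P∌ {e} e∈P = not-true (∧-trueʳ {A′ e} e∈P)

        ∈P : ∀ {e} → A′ e ≡ true → A e ≢ true → P e ≡ true
        ∈P e∈A′ e∉A = ∧-true e∈A′ (cong not (¬-not e∉A))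

        -- By `critical`, every connection of the ends of `g` in `A′` needs `e`. Hence the two ends
        -- of `e` are on opposite sides, and `g` can take the place of `e`.
        bridge : ∀ {e} → P e ≡ true →
          (Conn (A′ ∖ e) x (src e) × Conn (A′ ∖ e) (tgt e) y) ⊎
          (Conn (A′ ∖ e) x (tgt e) × Conn (A′ ∖ e) (src e) y)
        bridge {e} e∈P with split-∖ e linked
        ... | avoids p      = contradiction p
          (critical e (P⊑A′ e e∈P) (not-¬ (P∌ e∈P)))
        ... | forwards p q  = inj₁ (p , q)
        ... | backwards p q = inj₂ (p , q)

        Touched : V → Set
        Touched v = ∃ λ e → P e ≡ true × (v ≡ src e ⊎ v ≡ tgt e)

        touched? : ∀ v → Dec (Touched v)
        touched? v = any? λ e → (P e ≟ᵇ true) ×-dec ((v ≟ src e) ⊎-dec (v ≟ tgt e))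

        -- All ends of edges of `P` lie in the component of `A′` containing `g`, so a transversal of
        -- `A′` contains at most one of them.
        touched⇒x~ : ∀ {v} → Touched v → Conn A′ x v
        touched⇒x~ (e , e∈P , end) = go end (bridge e∈P)
          where
          up : ∀ {u v} → Conn (A′ ∖ e) u v → Conn A′ u v
          up = Conn-mono λ h → ∖-⊑ A′ e
          e~ : Conn A′ (src e) (tgt e)
          e~ = edge e (P⊑A′ e e∈P)
          go : ∀ {v} → v ≡ src e ⊎ v ≡ tgt e → _ → Conn A′ x v
          go (inj₁ refl) (inj₁ (p , _)) = up p
          go (inj₁ refl) (inj₂ (p , _)) = ~-trans (up p) (~-sym e~)
          go (inj₂ refl) (inj₁ (p , _)) = ~-trans (up p) e~
          go (inj₂ refl) (inj₂ (p , _)) = up p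

      S′ : V → Bool
      S′ v = S v ∧ not (does (touched? v))

      grows : size A < size A′
      grows with any? (λ e → P e ≟ᵇ true)
      ... | yes (e , e∈P) = subst (size A <_) (sym (size-─ A⊑A′)) (m<m+n (size A) (≤-<-trans z≤n (size-∖-< P e∈P)))
      ... | no none       = contradiction
        (Conn-mono (λ e e∈A′ → dec-stable (A e) λ e∉A → none (e , ∈P e∈A′ e∉A)) linked) g-apart
        where
        dec-stable : ∀ z → ¬ (z ≢ true) → z ≡ true
        dec-stable z = decidable-stable (z ≟ᵇ true)

      private
        unreleased : ∀ {v} → S′ v ≡ false → S v ≡ true → Touched v
        unreleased {v} v∉S′ v∈S with touched? v
        ... | yes t = t
        ... | no _  = contradiction (trans (sym (∧-true v∈S refl)) v∉S′) λ ()

        degree-A′ : ∀ v → degree A′ v ≡ degree A v + degree P v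
        degree-A′ v = ·-─ A⊑A′ (inc v)

        -- When no vertex of the transversal was just freed, the old relaxation with `P` added still
        -- works.
        module Unreleased {U} (transversal : Transversal A S U) where
          open Relaxation (relax U transversal)

          relaxation : Relaxation A′ U
          relaxation = record
            { B       = B ∪ P
            ; F⊑B     = λ e → ∪-⊑ˡ B P e ∘ F⊑B e
            ; B≤A     = ≤-trans (size-∪ B P) (≤-trans (+-monoˡ-≤ (size P) B≤A) (≤-reflexive (sym (size-─ A⊑A′))))
            ; spans   = spans′
            ; degrees = λ v → subst (λ z → degree (B ∪ P) v + degree T v + χ (U v) ≤ z + cap v) (sym (degree-A′ v))
                (≤-from (+-mono-≤ (degree-∪ B P v) (degrees v))
                  (identity (degree (B ∪ P) v) (degree B v) (degree P v) (degree A v) (degree T v)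
                    (χ (U v)) (cap v)))
            }
            where
            identity : ∀ b′ b p a t u c → b′ + t + u + (b + p + (a + c)) ≡ a + p + c + (b′ + (b + t + u))
            identity = solve-∀
            spans′ : Spans (B ∪ P) A′
            spans′ e e∈A′ with A e ≟ᵇ true
            ... | yes e∈A = Conn-mono (∪-⊑ˡ B P) (spans e e∈A)
            ... | no e∉A  = edge e (∪-⊑ʳ B P e (∈P e∈A′ e∉A))

        module Released {U′} (transversal′ : Transversal A′ S′ U′)
          (s : V) (s∈U′ : U′ s ≡ true) (s∈S : S s ≡ true)
          (e : Edge) (e∈P : P e ≡ true) (s-end : s ≡ src e ⊎ s ≡ tgt e) where

          open Transversal transversal′ renaming (outside to outside′; apart to apart′)

          x~s : Conn A′ x s
          x~s = touched⇒x~ (e , e∈P , s-end)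

          only-s : ∀ {v} → U′ v ≡ true → Conn A′ x v → v ≡ s
          only-s v∈U′ x~v = sym (apart′ s∈U′ v∈U′ (~-trans (~-sym x~s) x~v))

          s≢x : s ≢ x
          s≢x eq = not-¬ src∉S (trans (cong S (sym eq)) s∈S)

          s≢y : s ≢ y
          s≢y eq = not-¬ tgt∉S (trans (cong S (sym eq)) s∈S)

          -- The freed vertex `s` is replaced by both ends of `g`. These lie in different components
          -- of `A`, and `s` was the only vertex of `U′` in their common component of `A′`, so the
          -- result is a transversal for `A`.
          U : V → Bool
          U v = (U′ v ∧ not (δ v s)) ∨ (δ v x ∨ δ v y)

          data InU (v : V) : Set where
            old : U′ v ≡ true → v ≢ s → InU v
            isx : v ≡ x → InU v
            isy : v ≡ y → InU v

          inU : ∀ v → U v ≡ true → InU v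
          inU v p with v ≟ x | v ≟ y | v ≟ s | U′ v in v∈U′
          ... | yes v≡x | _       | _      | _     = isx v≡x
          ... | no _    | yes v≡y | _      | _     = isy v≡y
          inU v () | no _ | no _ | yes _  | true
          inU v () | no _ | no _ | yes _  | false
          ... | no _    | no _    | no v≢s | true  = old v∈U′ v≢s
          inU v () | no _ | no _ | no _   | false

          transversal : Transversal A S U
          transversal = record
            { outside = λ {u} p → outside (inU u p)
            ; apart   = λ {u} {v} p q → apart (inU u p) (inU v q)
            }
            where
            up : ∀ {u v} → Conn A u v → Conn A′ u v
            up = Conn-mono A⊑A′
            outside : ∀ {u} → InU u → S u ≡ false
            outside (isx refl) = src∉S
            outside (isy refl) = tgt∉S
            outside (old u∈U′ u≢s) =
              ¬-not λ u∈S → u≢s (only-s u∈U′ (touched⇒x~ (unreleased (outside′ u∈U′) u∈S)))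
            apart : ∀ {u v} → InU u → InU v → Conn A u v → u ≡ v
            apart (isx refl) (isx refl) _ = refl
            apart (isx refl) (isy refl) p = contradiction p g-apart
            apart (isx refl) (old v∈ v≢s) p = contradiction (only-s v∈ (up p)) v≢s
            apart (isy refl) (isx refl) p = contradiction (~-sym p) g-apart
            apart (isy refl) (isy refl) _ = refl
            apart (isy refl) (old v∈ v≢s) p = contradiction (only-s v∈ (~-trans linked (up p))) v≢s
            apart (old u∈ u≢s) (isx refl) p = contradiction (only-s u∈ (~-sym (up p))) u≢s
            apart (old u∈ u≢s) (isy refl) p = contradiction (only-s u∈ (~-trans linked (~-sym (up p)))) u≢s
            apart (old u∈ _) (old v∈ _) p = apart′ u∈ v∈ (up p)

          open Relaxation (relax U transversal)

          B′ : Edges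
          B′ = B ∪ (δ g ∪ (P ∖ e))

          B⊑B′ : B ⊑ B′
          B⊑B′ = ∪-⊑ˡ B (δ g ∪ (P ∖ e))

          g∈B′ : B′ g ≡ true
          g∈B′ = ∪-⊑ʳ B (δ g ∪ (P ∖ e)) g (∪-⊑ˡ (δ g) (P ∖ e) g (δ-refl g))

          -- Stated for arbitrary weights so that `const 1` gives the size bound and `inc v` the
          -- degree bound.
          weight-B′ : ∀ w → ⟦ B′ ⟧ · w + w e ≤ ⟦ B ⟧ · w + w g + ⟦ P ⟧ · w
          weight-B′ w = begin
            ⟦ B′ ⟧ · w + w e                                    ≤⟨ +-monoˡ-≤ (w e) (·-∪ B (δ g ∪ (P ∖ e)) w) ⟩
            ⟦ B ⟧ · w + ⟦ δ g ∪ (P ∖ e) ⟧ · w + w e             ≤⟨ +-monoˡ-≤ (w e) (+-monoʳ-≤ (⟦ B ⟧ · w) (·-∪ (δ g) (P ∖ e) w)) ⟩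
            ⟦ B ⟧ · w + (⟦ δ g ⟧ · w + ⟦ P ∖ e ⟧ · w) + w e     ≡⟨ cong (λ z → ⟦ B ⟧ · w + (z + ⟦ P ∖ e ⟧ · w) + w e) (⟦δ⟧-· g w) ⟩
            ⟦ B ⟧ · w + (w g + ⟦ P ∖ e ⟧ · w) + w e             ≡⟨ rearrange (⟦ B ⟧ · w) (w g) (⟦ P ∖ e ⟧ · w) (w e) ⟩
            ⟦ B ⟧ · w + w g + (⟦ P ∖ e ⟧ · w + w e)             ≡⟨ cong (⟦ B ⟧ · w + w g +_) (·-∖ P e∈P w) ⟩
            ⟦ B ⟧ · w + w g + ⟦ P ⟧ · w                         ∎
            where
            open ≤-Reasoning
            rearrange : ∀ b g p e → b + (g + p) + e ≡ b + g + (p + e)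
            rearrange = solve-∀

          spans-∖ : Spans B′ (A′ ∖ e)
          spans-∖ h h∈ with A h ≟ᵇ true
          ... | yes h∈A = Conn-mono B⊑B′ (spans h h∈A)
          ... | no h∉A  = edge h (∪-⊑ʳ B (δ g ∪ (P ∖ e)) h (∪-⊑ʳ (δ g) (P ∖ e) h
            (∈-∖ P e (∈P (∖-⊑ A′ e h∈) h∉A) λ { refl → ∉-∖ A′ e h∈ })))

          spans′ : Spans B′ A′
          spans′ h h∈ with e ≟ h
          ... | no e≢h = spans-∖ h (∈-∖ A′ e h∈ e≢h)
          -- The dropped edge `e` is bypassed: its ends are joined to the two ends of `g` without
          -- `e`, and `g` is in `B′`.
          ... | yes refl with bridge e∈P
          ...   | inj₁ (p , q) = ~-trans (~-sym (Conn-spans spans-∖ p)) (~-trans (edge g g∈B′) (~-sym (Conn-spans spans-∖ q)))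
          ...   | inj₂ (p , q) = ~-trans (Conn-spans spans-∖ q) (~-trans (~-sym (edge g g∈B′)) (Conn-spans spans-∖ p))

          -- At `s` the loss of `e` pays for the new slack. At an end of `g` the slack demanded by
          -- `U` pays for `g`, and `U′` demands none there. Elsewhere `U` and `U′` agree.
          trade : ∀ v → inc v g + χ (U′ v) ≤ χ (U v) + inc v e
          trade v with v ≟ s | v ≟ x | v ≟ y
          ... | yes refl | yes v≡x | _       = contradiction v≡x s≢x
          ... | yes refl | no _    | yes v≡y = contradiction v≡y s≢y
          ... | yes refl | no _    | no _    =
            ≤-trans (χ≤1 (U′ s)) (≤-trans (inc-end s-end) (m≤n+m _ (χ (U′ s ∧ false ∨ false))))
          ... | no _     | yes v≡x | yes v≡y = contradiction (trans (sym v≡x) v≡y) (loopless G g)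
          ... | no v≢s   | yes refl | no _   rewrite χ-false (λ p → v≢s (only-s p ~-refl)) | ∨-zeroʳ (U′ v ∧ true) = s≤s z≤n
          ... | no v≢s   | no _ | yes refl   rewrite χ-false (λ p → v≢s (only-s p linked)) | ∨-zeroʳ (U′ v ∧ true) = s≤s z≤n
          ... | no _     | no _    | no _    rewrite ∨-identityʳ (U′ v ∧ true) | ∧-identityʳ (U′ v) = m≤m+n (χ (U′ v)) _

          relaxation : Relaxation A′ U′
          relaxation = record
            { B       = B′
            ; F⊑B     = λ h → B⊑B′ h ∘ F⊑B h
            ; B≤A     = subst (size B′ ≤_) (sym (size-─ A⊑A′))
                (≤-from (+-mono-≤ size-B′ B≤A) (size-identity (size B′) (size B) (size P) (size A)))
            ; spans   = spans′
            ; degrees = λ v → subst (λ z → degree B′ v + degree T v + χ (U′ v) ≤ z + cap v) (sym (degree-A′ v))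
                (≤-from (+-mono-≤ (weight-B′ (inc v)) (+-mono-≤ (trade v) (degrees v)))
                  (identity (degree B′ v) (degree B v) (degree P v) (degree A v) (degree T v)
                    (χ (U v)) (χ (U′ v)) (inc v g) (inc v e) (cap v)))
            }
            where
            size-B′ : size B′ + 1 ≤ size B + 1 + size P
            size-B′ = begin
              size B′ + 1                                  ≡⟨ cong (_+ 1) (·-1 ⟦ B′ ⟧) ⟨
              ⟦ B′ ⟧ · const 1 + 1                         ≤⟨ weight-B′ (const 1) ⟩
              ⟦ B ⟧ · const 1 + 1 + ⟦ P ⟧ · const 1        ≡⟨ cong₂ (λ p q → p + 1 + q) (·-1 ⟦ B ⟧) (·-1 ⟦ P ⟧) ⟩
              size B + 1 + size P                          ∎
              where open ≤-Reasoning
            size-identity : ∀ b′ b p a → b′ + (b + 1 + p + a) ≡ a + p + (b′ + 1 + b)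
            size-identity = solve-∀
            identity : ∀ b′ b p a t u u′ g e c →
              b′ + t + u′ + (b + g + p + (u + e + (a + c))) ≡ a + p + c + (b′ + e + (g + u′ + (b + t + u)))
            identity = solve-∀

      relax′ : ∀ U′ → Transversal A′ S′ U′ → Relaxation A′ U′
      -- A vertex of `U′` in `S` was freed in this very step. There is at most one, so one trade
      -- suffices.
      relax′ U′ transversal′ with any? (λ v → (U′ v ≟ᵇ true) ×-dec (S v ≟ᵇ true))
      ... | yes (s , s∈U′ , s∈S) with unreleased (Transversal.outside transversal′ s∈U′) s∈S
      ...   | e , e∈P , s-end = Released.relaxation transversal′ s s∈U′ s∈S e e∈P s-end
      relax′ U′ transversal′ | no none = Unreleased.relaxation record
        { outside = λ u∈ → ¬-not λ u∈S → none (_ , u∈ , u∈S)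
        ; apart   = λ u∈ v∈ p → Transversal.apart transversal′ u∈ v∈ (Conn-mono A⊑A′ p)
        }

      -- For `cut`: an edge of `T` outside `F` at a vertex of `S′` is not in `A`; were it in `A′`,
      -- it would be in `P` and its ends would have left `S`.
      next : Stage A′ S′
      next = record
        { F⊑A       = λ e → A⊑A′ e ∘ F⊑A e
        ; A⊑T       = A′⊑T
        ; saturated = λ v → saturated v ∘ ∧-trueˡ
        ; cut       = λ e e∈T e∉F end → ¬-not λ e∈A′ → clash e e∈T e∉F e∈A′ end
        ; relax     = relax′
        }
        where
        S′-untouched : ∀ {v} → S′ v ≡ true → ¬ Touched v
        S′-untouched {v} v∈S′ t = contradiction
          (trans (sym (dec-true (touched? v) t)) (not-true (∧-trueʳ {S v} v∈S′))) λ ()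
        clash : ∀ e → T e ≡ true → F e ≡ false → A′ e ≡ true → S′ (src e) ≡ true ⊎ S′ (tgt e) ≡ true → ⊥
        clash e e∈T e∉F e∈A′ (inj₁ s∈S′) =
          S′-untouched s∈S′ (e , ∈P e∈A′ (not-¬ (cut e e∈T e∉F (inj₁ (∧-trueˡ s∈S′)))) , inj₁ refl)
        clash e e∈T e∉F e∈A′ (inj₂ t∈S′) =
          S′-untouched t∈S′ (e , ∈P e∈A′ (not-¬ (cut e e∈T e∉F (inj₂ (∧-trueˡ t∈S′)))) , inj₂ refl)

  -- Descent on the total excess

  excess : (V → ℕ) → Edges → ℕ
  excess b T = sum λ v → degree T v ∸ b v

  -- A degree can grow only up to `b v`, where the truncated difference is still 0. At `w` the
  -- maximum is the degree in `T`, so the unit of slack is a strict decrease.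
  excess-< : ∀ (b : V → ℕ) T T′ w → b w < degree T w →
    (∀ v → degree T′ v + χ (δ w v) ≤ degree T v ⊔ b v) → excess b T′ < excess b T
  excess-< b T T′ w b<d bound = begin-strict
    excess b T′                                         <⟨ n<1+n _ ⟩
    1 + excess b T′                                     ≡⟨ +-comm 1 _ ⟩
    excess b T′ + 1                                     ≡⟨ cong (excess b T′ +_) (size-δ w) ⟨
    excess b T′ + size (δ w)                            ≡⟨ ∑-distrib-+ (λ v → degree T′ v ∸ b v) ⟦ δ w ⟧ ⟨
    sum (λ v → (degree T′ v ∸ b v) + χ (δ w v))         ≤⟨ sum-mono pointwise ⟩
    excess b T                                          ∎
    where
    open ≤-Reasoning
    capped : ∀ d d′ c → d′ ≤ d ⊔ c → d′ ∸ c ≤ d ∸ c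
    capped d d′ c p = ≤-trans (∸-monoˡ-≤ c p) (≤-reflexive
      (trans (∸-distribʳ-⊔ c d c) (trans (cong ((d ∸ c) ⊔_) (n∸n≡0 c)) (⊔-identityʳ _))))
    below : ∀ d d′ c → c < d → d′ < d → d′ ∸ c < d ∸ c
    below d d′ c c<d d′<d with ≤-total c d′
    ... | inj₁ c≤d′ = ∸-monoˡ-< d′<d c≤d′
    ... | inj₂ d′≤c rewrite m≤n⇒m∸n≡0 d′≤c = m<n⇒0<n∸m c<d
    pointwise : ∀ v → (degree T′ v ∸ b v) + χ (δ w v) ≤ degree T v ∸ b v
    pointwise v with w ≟ v | bound v
    ... | no _     | p = ≤-trans (≤-reflexive (+-identityʳ _)) (capped (degree T v) (degree T′ v) (b v) (≤-trans (m≤m+n _ 0) p))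
    ... | yes refl | p = ≤-trans (≤-reflexive (+-comm _ 1)) (below (degree T w) (degree T′ w) (b w) b<d
      (≤-trans (≤-reflexive (+-comm 1 _)) (≤-trans p (≤-reflexive (m≥n⇒m⊔n≡m (<⇒≤ b<d))))))

  module _ (f : V → ℕ)
    (tough : ∀ (S : Subset (n G)) (k : ℕ) → HasComponents G S k →
      ℤ.+ k ℤ.≤ (sumOver G S (λ v → ℤ.+ f v ℤ.- ℤ.+ 2) ℤ.+ ℤ.+ 2)) (F : Edges) where

    private
      b : V → ℕ
      b v = f v + (degree F v ∸ 1)

    module _ {T} (tree : Tree T) (w : V) (b<d : b w < degree T w) where
      open Exchange {F} tree b

      -- The search ends because each step enlarges `A` inside `T`: either `w` leaves `S`, or no
      -- further `g` exists and the counting argument applies.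
      improvement : ∀ {A S} → Stage A S → Acc _<_ (size T ∸ size A) → Improved w
      improvement {A} {S} stage (acc rec) with S w ≟ᵇ true
      ... | no w∉S  = improve stage w (¬-not w∉S)
      ... | yes w∈S with any? (λ g → (S (src g) ≟ᵇ false) ×-dec (S (tgt g) ≟ᵇ false) ×-dec ¬? (conn? A (src g) (tgt g)))
      ...   | yes (g , s∉S , t∉S , apart)
        -- `T` connects the ends of `g`, so a minimal set between `A` and `T` doing so exists.
        with minimize (λ E → Conn E (src g) (tgt g)) (λ E → conn? E (src g) (tgt g))
               A T (Stage.A⊑T stage) (Tree.connected tree (src g) (tgt g))
      ...     | A′ , A⊑A′ , A′⊑T , linked , critical =
        improvement next (rec (∸-monoʳ-< grows (size-mono A′⊑T)))
        where open Advance stage g s∉S t∉S apart A⊑A′ A′⊑T linked critical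
      improvement {A} {S} stage (acc rec) | yes w∈S | no none =
        ⊥-elim (closed⇒⊥ f tough tree F⊑A A⊑T S cut w w∈S saturated′ closed)
        where
        open Stage stage
        saturated′ : ∀ v → S v ≡ true → b v + χ (δ w v) ≤ degree T v
        saturated′ v v∈S with w ≟ v
        ... | yes refl = ≤-trans (≤-reflexive (+-comm _ 1)) b<d
        ... | no _     = ≤-trans (≤-reflexive (+-identityʳ _)) (saturated v v∈S)
        closed : Spans A (outer S)
        closed e e∈ = decidable-stable (conn? A (src e) (tgt e)) λ apart →
          none (e , not-true (∧-trueˡ e∈) , not-true (∧-trueʳ {not (S (src e))} e∈) , apart)

    -- Well-founded descent on the excess takes the place of choosing a tree of least excess.
    bounded-tree : ∀ {T} → Tree T → F ⊑ T → Acc _<_ (excess b T) →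
      Σ Edges λ T′ → Tree T′ × F ⊑ T′ × (∀ v → degree T′ v ≤ b v)
    bounded-tree {T} tree F⊑T (acc rec) with any? (λ w → b w <? degree T w)
    ... | no none = T , tree , F⊑T , λ v → ≮⇒≥ λ b<d → none (v , b<d)
    ... | yes (w , b<d) with improvement tree w b<d (Exchange.initial tree b F⊑T) (<-wellFounded _)
    ...   | T′ , F⊑T′ , tree′ , bound = bounded-tree tree′ F⊑T′ (rec (excess-< b T T′ w b<d bound))

-- Translation between Boolean edge sets and `Subset`

theorem4p7 : (G : Graph) → IsConnected G → (f : Fin (n G) → ℕ) → (∀ v → 1 ≤ f v) →
    (∀ (S : Subset (n G)) (k : ℕ) → HasComponents G S k →
    ℤ.+ k ℤ.≤ (sumOver G S (λ v → ℤ.+ f v ℤ.- ℤ.+ 2) ℤ.+ ℤ.+ 2)) →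
    ∀ (F : Subset (m G)) → SpanningForest G F →
    Σ (Subset (m G)) λ T → SpanningTree G T × F ⊆ T ×
    (∀ v → deg G T v ≤ f v + (deg G F v ∸ 1))
theorem4p7 G connected f _ tough F forest with forest⇒tree connected (Acyclic⇒Acyc forest)
  where open Connectivity G
... | T₀ , F⊑T₀ , tree₀ with bounded-tree f tough (Vec.lookup F) tree₀ F⊑T₀ (<-wellFounded _)
  where open Connectivity G
...   | T , tree , F⊑T , bound = tabulate T ,
  (Acyc⇒Acyclic (Tree.acyc tree) ,
   λ u v → Conn⇒Connected (λ e e∈T → ∈-tabulate⁺ e∈T , ∈⊤ , ∈⊤) ∈⊤ (Tree.connected tree u v)) ,
  (λ {e} e∈F → ∈-tabulate⁺ (F⊑T e ([]=⇒lookup e∈F))) ,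
  λ v → begin
    deg G (tabulate T) v                    ≡⟨ deg≡degree (tabulate T) v ⟩
    degree (Vec.lookup (tabulate T)) v      ≡⟨ sum-cong-≗ (λ e → cong (λ z → χ z * inc v e) (lookup∘tabulate T e)) ⟩
    degree T v                              ≤⟨ bound v ⟩
    f v + (degree (Vec.lookup F) v ∸ 1)     ≡⟨ cong (λ z → f v + (z ∸ 1)) (deg≡degree F v) ⟨
    f v + (deg G F v ∸ 1)                   ∎
  where
  open Connectivity G
  open ≤-Reasoning
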